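{- Let $q$ be a prime power, $m,l,k$ integers with $3\le k\le\min\{m+1,l\}$, and $1\le r\le k-1$. Then the number of $G$-orbits on $\Omega_{k,r}^{k-1}$ is $$|\mathcal F_{k,r}^{k-1}|=n_{r+1}^l .$$ In particular, given a positive integer $u\mid\gcd(r+1,l)$, the number of $G$-orbits containing some $T(u_1,\dots,u_r)\in\Omega_{k,r}^{k-1}$ with $H_{\langle 1,u_1,\dots,u_r\rangle}\cong\mathrm{GF}(q^u)^*$ equals $n_{r+1,u}^l$.
   Context: $V$ is an $m$-dimensional vector space over $\mathrm{GF}(q^l)$ with basis $Y_1,\dots,Y_m$, regarded also as an $ml$-dimensional space over $\mathrm{GF}(q)$. $G=\mathrm{GL}(m,q^l)$ acts $\mathrm{GF}(q^l)$-linearly on $V$ and hence on its $\mathrm{GF}(q)$-subspaces. $H$ is a Singer cycle of $\mathrm{GF}(q^l)$, i.e. the group of multiplications by elements of $\mathrm{GF}(q^l)^*$, acting on $\mathrm{GF}(q)$-subspaces of $\mathrm{GF}(q^l)$; $H_W$ is the stabilizer of $W$ in $H$. $\langle\cdot\rangle$ denotes $\mathrm{GF}(q)$-span. For $1\le r\le k-1$ and $u_1,\dots,u_r\in\mathrm{GF}(q^l)$ with $1,u_1,\dots,u_r$ linearly independent over $\mathrm{GF}(q)$, $$T(u_1,\dots,u_r)=\langle Y_1,\dots,Y_{k-1},\,u_1Y_1+\cdots+u_rY_r\rangle,$$ a $k$-dimensional $\mathrm{GF}(q)$-subspace of $V$. $\Omega_{k,r}^{k-1}$ is the union of all $G$-orbits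 of such $T(u_1,\dots,u_r)$, and $\mathcal F_{k,r}^{k-1}$ is a complete set of representatives of the $G$-orbits on $\Omega_{k,r}^{k-1}$. $n_d^l$ is the number of $H$-orbits on the set of $d$-dimensional $\mathrm{GF}(q)$-subspaces of $\mathrm{GF}(q^l)$, and for $u\mid\gcd(d,l)$, $n_{d,u}^l$ is the number of those $H$-orbits whose members have stabilizer in $H$ isomorphic to $\mathrm{GF}(q^u)^*$. Explicitly, with $\mu$ the Möbius function and Gaussian binomial coefficients, $$n_d^l=\frac1{q^l-1}\sum_{t\mid\gcd(d,l)}\begin{bmatrix} l/t\\ d/t\end{bmatrix}_{q^t}\Big(\sum_{u\mid t}\mu(t/u)(q^u-1)\Big),\qquad n_{d,u}^l=\frac{q^u-1}{q^l-1}\sum_{t:\,u\mid t\mid\gcd(d,l)}\mu(t/u)\begin{bmatrix} l/t\\ d/t\end{bmatrix}_{q^t}.$$ -}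

module Defs where

open import Algebra.Bundles using (CommutativeRing; Group; Ring)
open import Algebra.Module.Bundles using (LeftModule)
open import Algebra.Module.Construct.TensorUnit using () renaming (leftModule to regularModule)
open import Algebra.Module.Morphism.Structures using (module LeftModuleMorphisms)
import Algebra.Definitions as AlgebraDefinitions
import Algebra.Module.Morphism.Construct.Composition as Composition
import Algebra.Module.Morphism.Construct.Identity as Identity
import Algebra.Properties.CommutativeMonoid.Sum as CommutativeMonoidSum
open import Algebra.Morphism.Bundles using (RingHomomorphism)
open import Algebra.Morphism.Structures using (module GroupMorphisms)
open import Data.Fin.Base using (Fin; inject≤)
open import Data.Nat.Base as ℕ using (ℕ; zero; suc)
import Data.Nat.Properties as ℕₚ
open import Data.Nat.Primality using (Prime)
open import Data.Product.Base using (Σ; ∃; ∃-syntax; _×_; _,_; proj₁; proj₂)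
open import Data.Vec.Functional using (Vector; []; _∷_; _++_)
open import Function.Base using (_∘_)
open import Function.Bundles using (Inverse)
open import Level using (Level; 0ℓ; _⊔_) renaming (suc to lsuc)
open import Relation.Binary.Bundles using (Setoid)
import Relation.Binary.Construct.On as On
open import Relation.Binary.PropositionalEquality.Core using (_≡_)
import Relation.Binary.PropositionalEquality.Properties as ≡
import Relation.Binary.Reasoning.Setoid as SetoidReasoning
open import Relation.Nullary.Negation.Core using (¬_)
open import Relation.Unary using (Pred; _≐_)
import Relation.Unary.Properties as Unary

private
  variable
    c ℓ p : Level

_HasSize_ : Setoid c ℓ → ℕ → Set (c ⊔ ℓ)
S HasSize n = Inverse S (≡.setoid (Fin n))

IsPrimePower : ℕ → Set
IsPrimePower q = ∃[ p ] ∃[ e ] Prime p × 1 ℕ.≤ e × q ≡ p ℕ.^ e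

_≅_ : Group 0ℓ 0ℓ → Group c ℓ → Set (c ⊔ ℓ)
A ≅ B = ∃ (GroupMorphisms.IsGroupIsomorphism (Group.rawGroup A) (Group.rawGroup B))

record GroupAction (G : Group 0ℓ 0ℓ) (S : Setoid c ℓ) : Set (c ⊔ ℓ) where
  open Group G using (_∙_; ε; _⁻¹; inverseˡ; inverseʳ) renaming (Carrier to ∣G∣; _≈_ to _≈ᴳ_)
  open Setoid S using (_≈_; refl; sym; trans) renaming (Carrier to X)
  infixr 7 _·_
  field
    _·_        : ∣G∣ → X → X
    ·-cong     : ∀ {g h x y} → g ≈ᴳ h → x ≈ y → g · x ≈ h · y
    ·-identity : ∀ x → ε · x ≈ x
    ·-compat   : ∀ g h x → (g ∙ h) · x ≈ g · h · x

  infix 4 _∼_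
  _∼_ : X → X → Set ℓ
  x ∼ y = ∃[ g ] g · x ≈ y

  private
    module G = Group G

    ·-inverse : ∀ {g x y} → g · x ≈ y → g ⁻¹ · y ≈ x
    ·-inverse {g} {x} gx≈y = trans (·-cong G.refl (sym gx≈y))
      (trans (sym (·-compat (g ⁻¹) g x)) (trans (·-cong (inverseˡ g) refl) (·-identity x)))

  orbitSetoid : Setoid c ℓ
  orbitSetoid = record
    { Carrier = X
    ; _≈_ = _∼_
    ; isEquivalence = record
      { refl  = λ {x} → ε , ·-identity x
      ; sym   = λ { (g , gx≈y) → g ⁻¹ , ·-inverse gx≈y }
      ; trans = λ { {x} (g , gx≈y) (h , hy≈z) →
          h ∙ g , trans (·-compat h g x) (trans (·-cong G.refl gx≈y) hy≈z) }
      }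
    }

  -- The orbits meeting P. For a G-invariant P these are the orbits on P.
  Orbits : Pred X p → Setoid (c ⊔ p) ℓ
  Orbits P = On.setoid orbitSetoid (proj₁ {B = P})

  Stabilizer : X → Group ℓ 0ℓ
  Stabilizer x = record
    { Carrier = ∃[ g ] g · x ≈ x
    ; _≈_ = λ g h → proj₁ g ≈ᴳ proj₁ h
    ; _∙_ = λ { (g , gx≈x) (h , hx≈x) →
        g ∙ h , trans (·-compat g h x) (trans (·-cong G.refl hx≈x) gx≈x) }
    ; ε = ε , ·-identity x
    ; _⁻¹ = λ { (g , gx≈x) → g ⁻¹ , ·-inverse gx≈x }
    ; isGroup = record
      { isMonoid = record
        { isSemigroup = record
          { isMagma = record
            { isEquivalence = On.isEquivalence proj₁ G.isEquivalence
            ; ∙-cong = G.∙-cong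
            }
          ; assoc = λ g h k → G.assoc (proj₁ g) (proj₁ h) (proj₁ k)
          }
        ; identity = (λ g → G.identityˡ (proj₁ g)) , (λ g → G.identityʳ (proj₁ g))
        }
      ; inverse = (λ g → inverseˡ (proj₁ g)) , (λ g → inverseʳ (proj₁ g))
      ; ⁻¹-cong = G.⁻¹-cong
      }
    }

module LinearAlgebra {R : Ring 0ℓ 0ℓ} (M : LeftModule R 0ℓ 0ℓ) where
  private
    module R = Ring R
  open LeftModule M
  open CommutativeMonoidSum +ᴹ-commutativeMonoid using (sum; sum-cong-≋; sum-replicate-zero; ∑-distrib-+)
  open LeftModuleMorphisms rawLeftModule rawLeftModule

  lincomb : ∀ {n} → Vector R.Carrier n → Vector Carrierᴹ n → Carrierᴹ
  lincomb a v = sum (λ i → a i *ₗ v i)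

  LinearlyIndependent : ∀ {n} → Pred (Vector Carrierᴹ n) 0ℓ
  LinearlyIndependent v = ∀ a → lincomb a v ≈ᴹ 0ᴹ → ∀ i → a i R.≈ R.0#

  IsBasis : ∀ {n} → Pred (Vector Carrierᴹ n) 0ℓ
  IsBasis v = LinearlyIndependent v × (∀ x → ∃[ a ] lincomb a v ≈ᴹ x)

  record Subspace : Set₁ where
    field
      member    : Pred Carrierᴹ 0ℓ
      ≈-closed  : ∀ {x y} → x ≈ᴹ y → member x → member y
      0-closed  : member 0ᴹ
      +-closed  : ∀ {x y} → member x → member y → member (x +ᴹ y)
      *ₗ-closed : ∀ a {x} → member x → member (a *ₗ x)

  open Subspace

  subspaceSetoid : Setoid (lsuc 0ℓ) 0ℓ
  subspaceSetoid = record
    { Carrier = Subspace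
    ; _≈_ = λ U W → member U ≐ member W
    ; isEquivalence = record { refl = Unary.≐-refl ; sym = Unary.≐-sym ; trans = Unary.≐-trans }
    }

  private
    lincomb-*ₗ : ∀ {n} b (a : Vector R.Carrier n) v → lincomb (λ i → b R.* a i) v ≈ᴹ b *ₗ lincomb a v
    lincomb-*ₗ {zero}  b a v = ≈ᴹ-sym (*ₗ-zeroʳ b)
    lincomb-*ₗ {suc n} b a v = ≈ᴹ-trans
      (+ᴹ-cong (*ₗ-assoc _ _ _) (lincomb-*ₗ b (a ∘ Fin.suc) (v ∘ Fin.suc)))
      (≈ᴹ-sym (*ₗ-distribˡ _ _ _))

  span : ∀ {n} → Vector Carrierᴹ n → Subspace
  span {n} v = record
    { member    = λ x → ∃[ a ] lincomb a v ≈ᴹ x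
    ; ≈-closed  = λ { x≈y (a , av≈x) → a , ≈ᴹ-trans av≈x x≈y }
    ; 0-closed  = (λ _ → R.0#) , ≈ᴹ-trans (sum-cong-≋ (λ i → *ₗ-zeroˡ (v i))) (sum-replicate-zero n)
    ; +-closed  = λ { (a , av≈x) (b , bv≈y) → (λ i → a i R.+ b i) ,
        ≈ᴹ-trans (sum-cong-≋ (λ i → *ₗ-distribʳ (v i) (a i) (b i)))
          (≈ᴹ-trans (∑-distrib-+ (λ i → a i *ₗ v i) (λ i → b i *ₗ v i)) (+ᴹ-cong av≈x bv≈y)) }
    ; *ₗ-closed = λ { b (a , av≈x) → (λ i → b R.* a i) ,
        ≈ᴹ-trans (lincomb-*ₗ b a v) (*ₗ-cong R.refl av≈x) }
    }

  HasDimension : ℕ → Pred Subspace 0ℓ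
  HasDimension d U = Σ (Vector Carrierᴹ d) λ v →
    LinearlyIndependent v × member U ≐ member (span v)

  record LinearAction (G : Group 0ℓ 0ℓ) : Set where
    field
      groupAction    : GroupAction G ≈ᴹ-setoid
    open GroupAction groupAction public
    field
      isHomomorphism : ∀ g → IsLeftModuleHomomorphism (g ·_)

  module _ {G : Group 0ℓ 0ℓ} (act : LinearAction G) where
    private
      module G = Group G
    open LinearAction act

    image : G.Carrier → Subspace → Subspace
    image g U = record
      { member    = λ y → ∃[ x ] member U x × g · x ≈ᴹ y
      ; ≈-closed  = λ { y≈z (x , x∈U , gx≈y) → x , x∈U , ≈ᴹ-trans gx≈y y≈z }
      ; 0-closed  = 0ᴹ , 0-closed U , g.0ᴹ-homo
      ; +-closed  = λ { (x , x∈U , gx≈y) (x′ , x′∈U , gx′≈y′) →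
          x +ᴹ x′ , +-closed U x∈U x′∈U , ≈ᴹ-trans (g.+ᴹ-homo x x′) (+ᴹ-cong gx≈y gx′≈y′) }
      ; *ₗ-closed = λ { a (x , x∈U , gx≈y) →
          a *ₗ x , *ₗ-closed U a x∈U , ≈ᴹ-trans (g.*ₗ-homo a x) (*ₗ-cong R.refl gx≈y) }
      }
      where module g = IsLeftModuleHomomorphism (isHomomorphism g)

    subspaceAction : GroupAction G subspaceSetoid
    subspaceAction = record
      { _·_ = image
      ; ·-cong = λ g≈h (U⊆W , W⊆U) →
          (λ (x , x∈U , gx≈y) → x , U⊆W x∈U , ≈ᴹ-trans (·-cong (G.sym g≈h) ≈ᴹ-refl) gx≈y) ,
          (λ (x , x∈W , hx≈y) → x , W⊆U x∈W , ≈ᴹ-trans (·-cong g≈h ≈ᴹ-refl) hx≈y)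
      ; ·-identity = λ U →
          (λ (x , x∈U , 1x≈y) → ≈-closed U (≈ᴹ-trans (≈ᴹ-sym (·-identity x)) 1x≈y) x∈U) ,
          (λ {y} y∈U → y , y∈U , ·-identity y)
      ; ·-compat = λ g h U →
          (λ (x , x∈U , ghx≈y) →
            h · x , (x , x∈U , ≈ᴹ-refl) , ≈ᴹ-trans (≈ᴹ-sym (·-compat g h x)) ghx≈y) ,
          (λ (z , (x , x∈U , hx≈z) , gz≈y) →
            x , x∈U , ≈ᴹ-trans (·-compat g h x) (≈ᴹ-trans (·-cong G.refl hx≈z) gz≈y))
      }

module _ {R : Ring 0ℓ 0ℓ} (M : LeftModule R 0ℓ 0ℓ) where
  open LeftModule M
  open LeftModuleMorphisms rawLeftModule rawLeftModule
  private
    module R = Ring R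

  record Automorphism : Set where
    field
      to    : Carrierᴹ → Carrierᴹ
      isIso : IsLeftModuleIsomorphism to
    open IsLeftModuleIsomorphism isIso public

    from : Carrierᴹ → Carrierᴹ
    from y = proj₁ (surjective y)

    to-from : ∀ y → to (from y) ≈ᴹ y
    to-from y = proj₂ (surjective y) ≈ᴹ-refl

    from-to : ∀ x → from (to x) ≈ᴹ x
    from-to x = injective (to-from (to x))

    from-unique : ∀ {x y} → to x ≈ᴹ y → from y ≈ᴹ x
    from-unique {x} {y} tx≈y = injective (≈ᴹ-trans (to-from y) (≈ᴹ-sym tx≈y))

    from-cong : ∀ {x y} → x ≈ᴹ y → from x ≈ᴹ from y
    from-cong x≈y = from-unique (≈ᴹ-trans (to-from _) (≈ᴹ-sym x≈y))

  open Automorphism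

  private
    idᴬ : Automorphism
    idᴬ = record { to = λ x → x ; isIso = Identity.isLeftModuleIsomorphism rawLeftModule ≈ᴹ-refl }

    _∘ᴬ_ : Automorphism → Automorphism → Automorphism
    g ∘ᴬ h = record
      { to = to g ∘ to h
      ; isIso = Composition.isLeftModuleIsomorphism ≈ᴹ-trans (isIso h) (isIso g)
      }

    invᴬ : Automorphism → Automorphism
    invᴬ g = record
      { to = from g
      ; isIso = record
        { isLeftModuleMonomorphism = record
          { isLeftModuleHomomorphism = record
            { +ᴹ-isGroupHomomorphism = record
              { isMonoidHomomorphism = record
                { isMagmaHomomorphism = record
                  { isRelHomomorphism = record { cong = from-cong g }
                  ; homo = λ x y → from-unique g
                      (≈ᴹ-trans (+ᴹ-homo g _ _) (+ᴹ-cong (to-from g x) (to-from g y)))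
                  }
                ; ε-homo = from-unique g (0ᴹ-homo g)
                }
              ; ⁻¹-homo = λ x → from-unique g (≈ᴹ-trans (-ᴹ-homo g _) (-ᴹ‿cong (to-from g x)))
              }
            ; *ₗ-homo = λ a x → from-unique g
                (≈ᴹ-trans (*ₗ-homo g a _) (*ₗ-cong R.refl (to-from g x)))
            }
          ; injective = λ {x} {y} fx≈fy →
              ≈ᴹ-trans (≈ᴹ-sym (to-from g x)) (≈ᴹ-trans (⟦⟧-cong g fx≈fy) (to-from g y))
          }
        ; surjective = λ y → to g y , λ z≈ty → from-unique g (≈ᴹ-sym z≈ty)
        }
      }

  GL : Group 0ℓ 0ℓ
  GL = record
    { Carrier = Automorphism
    ; _≈_ = λ g h → ∀ x → to g x ≈ᴹ to h x
    ; _∙_ = _∘ᴬ_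
    ; ε = idᴬ
    ; _⁻¹ = invᴬ
    ; isGroup = record
      { isMonoid = record
        { isSemigroup = record
          { isMagma = record
            { isEquivalence = record
              { refl  = λ x → ≈ᴹ-refl
              ; sym   = λ g≈h x → ≈ᴹ-sym (g≈h x)
              ; trans = λ g≈h h≈k x → ≈ᴹ-trans (g≈h x) (h≈k x)
              }
            ; ∙-cong = λ {g} {g′} {h} {h′} g≈g′ h≈h′ x →
                ≈ᴹ-trans (⟦⟧-cong g (h≈h′ x)) (g≈g′ (to h′ x))
            }
          ; assoc = λ g h k x → ≈ᴹ-refl
          }
        ; identity = (λ g x → ≈ᴹ-refl) , (λ g x → ≈ᴹ-refl)
        }
      ; inverse = from-to , to-from
      ; ⁻¹-cong = λ {g} {h} g≈h x → from-unique g (≈ᴹ-trans (g≈h _) (to-from h x))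
      }
    }

  GL-action : LinearAlgebra.LinearAction M GL
  GL-action = record
    { groupAction = record
      { _·_ = to
      ; ·-cong = λ {g} {h} {x} {y} g≈h x≈y → ≈ᴹ-trans (⟦⟧-cong g x≈y) (g≈h y)
      ; ·-identity = λ x → ≈ᴹ-refl
      ; ·-compat = λ g h x → ≈ᴹ-refl
      }
    ; isHomomorphism = λ g → isLeftModuleHomomorphism g
    }

module _ (A B : Ring 0ℓ 0ℓ) (ι : RingHomomorphism (Ring.rawRing A) (Ring.rawRing B)) where
  open RingHomomorphism ι

  restrictScalars : LeftModule B 0ℓ 0ℓ → LeftModule A 0ℓ 0ℓ
  restrictScalars M = record
    { Carrierᴹ = Carrierᴹ
    ; _≈ᴹ_ = _≈ᴹ_
    ; _+ᴹ_ = _+ᴹ_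
    ; _*ₗ_ = λ a x → ⟦ a ⟧ *ₗ x
    ; 0ᴹ = 0ᴹ
    ; -ᴹ_ = -ᴹ_
    ; isLeftModule = record
      { isLeftSemimodule = record
        { +ᴹ-isCommutativeMonoid = +ᴹ-isCommutativeMonoid
        ; isPreleftSemimodule = record
          { *ₗ-cong = λ a≈b x≈y → *ₗ-cong (⟦⟧-cong a≈b) x≈y
          ; *ₗ-zeroˡ = λ x → ≈ᴹ-trans (*ₗ-cong 0#-homo ≈ᴹ-refl) (*ₗ-zeroˡ x)
          ; *ₗ-distribʳ = λ x a b → ≈ᴹ-trans (*ₗ-cong (+-homo a b) ≈ᴹ-refl) (*ₗ-distribʳ x _ _)
          ; *ₗ-identityˡ = λ x → ≈ᴹ-trans (*ₗ-cong 1#-homo ≈ᴹ-refl) (*ₗ-identityˡ x)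
          ; *ₗ-assoc = λ a b x → ≈ᴹ-trans (*ₗ-cong (*-homo a b) ≈ᴹ-refl) (*ₗ-assoc _ _ x)
          ; *ₗ-zeroʳ = λ a → *ₗ-zeroʳ ⟦ a ⟧
          ; *ₗ-distribˡ = λ a → *ₗ-distribˡ ⟦ a ⟧
          }
        }
      ; -ᴹ‿cong = -ᴹ‿cong
      ; -ᴹ‿inverse = -ᴹ‿inverse
      }
    }
    where open LeftModule M

  restrictAction : (M : LeftModule B 0ℓ 0ℓ) {G : Group 0ℓ 0ℓ} →
                   LinearAlgebra.LinearAction M G →
                   LinearAlgebra.LinearAction (restrictScalars M) G
  restrictAction M act = record
    { groupAction = groupAction
    ; isHomomorphism = λ g → let open H (isHomomorphism g) in record
      { +ᴹ-isGroupHomomorphism = +ᴹ-isGroupHomomorphism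
      ; *ₗ-homo = λ a → *ₗ-homo ⟦ a ⟧
      }
    }
    where
    open LinearAlgebra.LinearAction act
    module H {f} = LeftModuleMorphisms.IsLeftModuleHomomorphism
      {M₁ = LeftModule.rawLeftModule M} {M₂ = LeftModule.rawLeftModule M} {⟦_⟧ = f}

record FiniteField (n : ℕ) : Set₁ where
  field
    commutativeRing : CommutativeRing 0ℓ 0ℓ
  open CommutativeRing commutativeRing public
  open AlgebraDefinitions _≈_ using (Invertible)
  field
    1≉0        : ¬ 1# ≈ 0#
    invertible : ∀ x → ¬ x ≈ 0# → Invertible 1# _*_ x
    size       : setoid HasSize n

module _ {n : ℕ} (K : FiniteField n) where
  open FiniteField K
  open SetoidReasoning setoid

  private
    *-nonzero : ∀ {x y} → ¬ x ≈ 0# → ¬ y ≈ 0# → ¬ x * y ≈ 0#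
    *-nonzero {x} {y} x≉0 y≉0 xy≈0 = let (x⁻¹ , x⁻¹x≈1 , _) = invertible x x≉0 in y≉0 (begin
      y               ≈⟨ *-identityˡ y ⟨
      1# * y          ≈⟨ *-congʳ x⁻¹x≈1 ⟨
      (x⁻¹ * x) * y   ≈⟨ *-assoc x⁻¹ x y ⟩
      x⁻¹ * (x * y)   ≈⟨ *-congˡ xy≈0 ⟩
      x⁻¹ * 0#        ≈⟨ zeroʳ x⁻¹ ⟩
      0#              ∎)

    inverse-unique : ∀ {x y z} → y * x ≈ 1# → x * z ≈ 1# → y ≈ z
    inverse-unique {x} {y} {z} yx≈1 xz≈1 = begin
      y            ≈⟨ *-identityʳ y ⟨
      y * 1#       ≈⟨ *-congˡ xz≈1 ⟨
      y * (x * z)  ≈⟨ *-assoc y x z ⟨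
      (y * x) * z  ≈⟨ *-congʳ yx≈1 ⟩
      1# * z       ≈⟨ *-identityˡ z ⟩
      z            ∎

  multiplicativeGroup : Group 0ℓ 0ℓ
  multiplicativeGroup = record
    { Carrier = ∃[ x ] ¬ x ≈ 0#
    ; _≈_ = λ x y → proj₁ x ≈ proj₁ y
    ; _∙_ = λ (x , x≉0) (y , y≉0) → x * y , *-nonzero x≉0 y≉0
    ; ε = 1# , 1≉0
    ; _⁻¹ = λ (x , x≉0) → let (x⁻¹ , x⁻¹x≈1 , _) = invertible x x≉0 in x⁻¹ ,
        λ x⁻¹≈0 → 1≉0 (trans (sym x⁻¹x≈1) (trans (*-congʳ x⁻¹≈0) (zeroˡ x)))
    ; isGroup = record
      { isMonoid = record
        { isSemigroup = record
          { isMagma = record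
            { isEquivalence = On.isEquivalence proj₁ isEquivalence
            ; ∙-cong = *-cong
            }
          ; assoc = λ (x , _) (y , _) (z , _) → *-assoc x y z
          }
        ; identity = (λ (x , _) → *-identityˡ x) , (λ (x , _) → *-identityʳ x)
        }
      ; inverse =
          (λ (x , x≉0) → proj₁ (proj₂ (invertible x x≉0))) ,
          (λ (x , x≉0) → proj₂ (proj₂ (invertible x x≉0)))
      ; ⁻¹-cong = λ { {x , x≉0} {y , y≉0} x≈y → inverse-unique
          (proj₁ (proj₂ (invertible x x≉0)))
          (trans (*-congʳ x≈y) (proj₂ (proj₂ (invertible y y≉0)))) }
      }
    }

  multiplicationAction : LinearAlgebra.LinearAction (regularModule {R = ring}) multiplicativeGroup
  multiplicationAction = record
    { groupAction = record
      { _·_ = λ (h , _) x → h * x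
      ; ·-cong = *-cong
      ; ·-identity = *-identityˡ
      ; ·-compat = λ (g , _) (h , _) x → *-assoc g h x
      }
    ; isHomomorphism = λ (h , _) → record
      { +ᴹ-isGroupHomomorphism = record
        { isMonoidHomomorphism = record
          { isMagmaHomomorphism = record
            { isRelHomomorphism = record { cong = *-congˡ }
            ; homo = distribˡ h
            }
          ; ε-homo = zeroʳ h
          }
        ; ⁻¹-homo = λ x → sym (-‿distribʳ-* h x)
        }
      ; *ₗ-homo = λ a x → trans (sym (*-assoc h a x)) (trans (*-congʳ (*-comm h a)) (*-assoc a h x))
      }
    }
    where open import Algebra.Properties.Ring ring using (-‿distribʳ-*)

-- F = GF(q), embedded by ι in K = GF(q^l); V is a vector space over K
-- with basis Y. The Y i with i < k - 1 play the role of Y₁, …, Y_{k-1}.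

module Setting
  {q l m k r : ℕ} (F : FiniteField q) (K : FiniteField (q ℕ.^ l))
  (ι : RingHomomorphism (FiniteField.rawRing F) (FiniteField.rawRing K))
  (V : LeftModule (FiniteField.ring K) 0ℓ 0ℓ) (Y : Vector (LeftModule.Carrierᴹ V) m)
  (k≤[m+1]⊓l : k ℕ.≤ (m ℕ.+ 1) ℕ.⊓ l) (r≤k-1 : r ℕ.≤ k ℕ.∸ 1)
  where

  private
    module F = FiniteField F
    module K = FiniteField K

  K/K : LeftModule K.ring 0ℓ 0ℓ
  K/K = regularModule

  K/F : LeftModule F.ring 0ℓ 0ℓ
  K/F = restrictScalars F.ring K.ring ι K/K

  V/F : LeftModule F.ring 0ℓ 0ℓ
  V/F = restrictScalars F.ring K.ring ι V

  k-1≤m : k ℕ.∸ 1 ℕ.≤ m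
  k-1≤m = ℕₚ.≤-trans
    (ℕₚ.∸-monoˡ-≤ 1 (ℕₚ.m≤n⊓o⇒m≤n (m ℕ.+ 1) l k≤[m+1]⊓l))
    (ℕₚ.≤-reflexive (ℕₚ.m+n∸n≡m m 1))

  module K/F = LinearAlgebra K/F
  module V/F = LinearAlgebra V/F

  -- G = GL(m, q^l) is taken as the group of K-linear automorphisms of V, and
  -- the Singer cycle H as the group of multiplications by nonzero elements of K.
  module G-action = GroupAction (V/F.subspaceAction (restrictAction F.ring K.ring ι V (GL-action V)))
  module H-action = GroupAction (K/F.subspaceAction (restrictAction F.ring K.ring ι K/K (multiplicationAction K)))

  T : Vector K.Carrier r → V/F.Subspace
  T u = V/F.span
    ((λ i → Y (inject≤ i k-1≤m)) ++
     (LinearAlgebra.lincomb V u (λ i → Y (inject≤ i (ℕₚ.≤-trans r≤k-1 k-1≤m))) ∷ []))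

  Ω : Pred V/F.Subspace 0ℓ
  Ω U = ∃[ u ] K/F.LinearlyIndependent (K.1# ∷ u) × T u G-action.∼ U

  HasStabilizer : ∀ {n} → FiniteField n → Pred K/F.Subspace 0ℓ
  HasStabilizer L W = H-action.Stabilizer W ≅ multiplicativeGroup L

  -- The members of those orbits on Ω which contain some T(u) such that the
  -- stabilizer of ⟨ 1 , u ⟩ is isomorphic to the multiplicative group of L.
  Ω[_] : ∀ {n} → FiniteField n → Pred V/F.Subspace 0ℓ
  Ω[ L ] U = ∃[ u ] K/F.LinearlyIndependent (K.1# ∷ u) ×
    HasStabilizer L (K/F.span (K.1# ∷ u)) × T u G-action.∼ U

  -- n_d^l is the size of H-Orbits d, and n_{d,u}^l that of H-Orbits[ L ] d for
  -- L = GF(q^u).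
  H-Orbits : ℕ → Setoid (lsuc 0ℓ) 0ℓ
  H-Orbits d = H-action.Orbits (K/F.HasDimension d)

  H-Orbits[_] : ∀ {n} → FiniteField n → ℕ → Setoid (lsuc 0ℓ) 0ℓ
  H-Orbits[ L ] d = H-action.Orbits (λ W → K/F.HasDimension d W × HasStabilizer L W)

  G-Orbits : Setoid (lsuc 0ℓ) 0ℓ
  G-Orbits = G-action.Orbits Ω

  G-Orbits[_] : ∀ {n} → FiniteField n → Setoid (lsuc 0ℓ) 0ℓ
  G-Orbits[ L ] = G-action.Orbits Ω[ L ]

{-# OPTIONS --safe #-}

-- For V ≅ K^m put e(u) = (1, u) and s(u) = (− Σ u_i Y_i, Y_1, …, Y_r), so that T(u) is spanned
-- over F by s(u) and Y_{r+1}, …, Y_{k−1}, and every K-linear relation among these generators is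
-- a multiple of e(u) · s(u) = 0. A map g ∈ GL(V) with g T(u) = T(u′) must preserve the relation
-- up to a scalar κ, which forces g s(u) = A s(u′) with an invertible matrix A over F and
-- e(u) A = κ e(u′), that is κ ⟨1, u′⟩ = ⟨1, u⟩. Conversely such an A extends to an automorphism
-- of V. Hence T(u) ↦ ⟨1, u⟩ is a bijection from the G-orbits on Ω to the H-orbits of
-- (r+1)-dimensional subspaces, every such orbit containing some ⟨1, u⟩. As H is abelian, the
-- stabilizer is constant on H-orbits.
--
-- Constructively, the orbit counts exist because the orbit relation and the existence of an
-- isomorphism between a stabilizer and GF(q^u)^* are decided by exhaustive search.
module Submission where

open import Defs
open import Algebra.Bundles using (CommutativeRing; Group; Ring)
open import Algebra.Definitions using (Commutative)
open import Algebra.Module.Bundles using (LeftModule)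
open import Algebra.Module.Construct.TensorUnit using () renaming (leftModule to regularModule)
import Algebra.Module.Morphism.Construct.Composition as ModuleComposition
import Algebra.Module.Morphism.Construct.Identity as ModuleIdentity
open import Algebra.Module.Morphism.Structures using (module LeftModuleMorphisms)
import Algebra.Module.Properties.LeftModule as LeftModuleProperties
open import Algebra.Morphism.Bundles using (RingHomomorphism)
import Algebra.Morphism.Construct.Composition as GroupComposition
open import Algebra.Morphism.Structures using (module GroupMorphisms)
import Algebra.Properties.CommutativeMonoid.Sum as CommutativeMonoidSum
import Algebra.Properties.Group as GroupProperties
import Algebra.Properties.Ring as RingProperties
open import Data.Fin.Base using
  (Fin; zero; suc; _↑ˡ_; _↑ʳ_; combine; finToFun; fromℕ<; funToFin; inject≤; punchIn; punchOut; splitAt; toℕ)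
open import Data.Fin.Properties as Fin using
  (any?; all?; finToFun-funToFin; funToFin-finToFin; punchIn-punchOut; splitAt⁻¹-↑ˡ; splitAt⁻¹-↑ʳ)
open import Data.Nat.Base using (ℕ; zero; suc; _+_; _∸_; _^_; _⊓_; _≤_)
open import Data.Nat.Divisibility using (_∣_)
open import Data.Nat.GCD using (gcd)
import Data.Nat.Properties as ℕ
open import Data.Product.Base using (Σ; ∃; ∃-syntax; _×_; _,_; proj₁; proj₂)
open import Data.Sum.Base using (inj₁; inj₂)
open import Data.Vec.Functional using (Vector; []; _∷_; _++_)
open import Data.Vec.Functional.Properties using (lookup-++ˡ; lookup-++ʳ)
open import Data.Vec.Functional.Relation.Binary.Equality.Setoid using (≋-setoid)
open import Function.Base using (_∘_)
open import Function.Bundles using (Inverse)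
import Function.Construct.Composition as Composition
open import Level using (Level; 0ℓ)
open import Relation.Binary.Bundles using (Setoid)
open import Relation.Binary.Definitions using (_Respects_) renaming (Decidable to Decidable₂)
open import Relation.Binary.PropositionalEquality as ≡ using (_≡_)
import Relation.Binary.Reasoning.Setoid as SetoidReasoning
open import Relation.Nullary using (Dec; yes; no; ¬_; ¬?; contradiction)
open import Relation.Nullary.Decidable using (map′; _×-dec_; _→-dec_; decidable-stable)
open import Relation.Unary using (Pred; Decidable; _⊆_; _≐_)

-- Finite setoids: quotients, subquotients and exhaustive search

private
  variable
    s₁ s₂ ℓ₁ ℓ₂ p : Level

-- Proofs of `P i` need not be unique, so the covering clause compares indices only and promises
-- nothing about which proof is attached.
filter : ∀ {N} {P : Pred (Fin N) p} → Decidable P →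
         ∃[ n ] Σ (Fin n → ∃ P) λ f → ∀ {i} → P i → ∃[ j ] proj₁ (f j) ≡ i
filter {N = zero}  P? = 0 , (λ ()) , λ { {()} }
filter {N = suc N} P? with P? zero | filter (P? ∘ suc)
... | yes p₀ | n , f , cover =
  suc n ,
  (λ { zero → zero , p₀ ; (suc j) → suc (proj₁ (f j)) , proj₂ (f j) }) ,
  λ { {zero} _ → zero , ≡.refl
    ; {suc i} p → let (j , fj≡i) = cover p in suc j , ≡.cong suc fj≡i }
... | no ¬p₀ | n , f , cover =
  n ,
  (λ j → suc (proj₁ (f j)) , proj₂ (f j)) ,
  λ { {zero} p → contradiction p ¬p₀
    ; {suc i} p → let (j , fj≡i) = cover p in j , ≡.cong suc fj≡i }

module _ (S : Setoid s₁ ℓ₁) (_≟_ : Decidable₂ (Setoid._≈_ S)) where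
  open Setoid S

  -- Induction on the length of the enumeration. A repetition up to `≈` is dropped, which shortens
  -- the list; once there is none, `e` is injective and is itself the bijection.
  finiteQuotient : ∀ {N} (e : Fin N → Carrier) → (∀ x → ∃[ i ] e i ≈ x) → ∃[ n ] S HasSize n
  finiteQuotient {zero}  e cover = 0 , record
    { to        = proj₁ ∘ cover
    ; from      = λ ()
    ; to-cong   = λ {x} → contradiction (proj₁ (cover x)) λ ()
    ; from-cong = λ { {()} }
    ; inverse   = (λ { {()} }) , λ {x} → contradiction (proj₁ (cover x)) λ ()
    }
  finiteQuotient {suc N} e cover
    with any? (λ i → any? (λ j → ¬? (i Fin.≟ j) ×-dec e j ≟ e i))
  ... | yes (i , j , i≢j , ej≈ei) = finiteQuotient (e ∘ punchIn i) cover′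
    where
    cover′ : ∀ x → ∃[ k ] e (punchIn i k) ≈ x
    cover′ x with cover x
    ... | k , ek≈x with i Fin.≟ k
    -- The dropped index `i` is represented by its duplicate `j`.
    ...   | yes ≡.refl = punchOut i≢j ,
            trans (reflexive (≡.cong e (punchIn-punchOut i≢j))) (trans ej≈ei ek≈x)
    ...   | no i≢k     = punchOut i≢k ,
            trans (reflexive (≡.cong e (punchIn-punchOut i≢k))) ek≈x
  ... | no no-duplicates = suc N , record
    { to        = to
    ; from      = e
    -- `cover` is a mere choice of index; it respects `≈` because `e` is injective.
    ; to-cong   = λ {x} {y} x≈y → e-injective (trans (e∘to x) (trans x≈y (sym (e∘to y))))
    ; from-cong = reflexive ∘ ≡.cong e
    ; inverse   = (λ {i} {x} x≈ei → e-injective (trans (e∘to x) x≈ei)) ,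
                  (λ {x} i≡tox → trans (reflexive (≡.cong e i≡tox)) (e∘to x))
    }
    where
    to : Carrier → Fin (suc N)
    to = proj₁ ∘ cover

    e∘to : ∀ x → e (to x) ≈ x
    e∘to = proj₂ ∘ cover

    e-injective : ∀ {i j} → e i ≈ e j → i ≡ j
    e-injective {i} {j} ei≈ej = decidable-stable (i Fin.≟ j)
      λ i≢j → no-duplicates (i , j , i≢j , sym ei≈ej)

module Finite {S : Setoid s₁ ℓ₁} {n : ℕ} (S↔n : S HasSize n) where
  open Setoid S
  open Inverse S↔n

  from∘to : ∀ x → from (to x) ≈ x
  from∘to x = strictlyInverseʳ x

  infix 4 _≟_
  _≟_ : Decidable₂ _≈_
  x ≟ y = map′
    (λ eq → trans (sym (from∘to x)) (trans (from-cong eq) (from∘to y)))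
    to-cong (to x Fin.≟ to y)

  ∃? : ∀ {P : Pred Carrier p} → P Respects _≈_ → Decidable P → Dec (∃ P)
  ∃? resp P? = map′
    (λ (i , pi) → from i , pi)
    (λ (x , px) → to x , resp (sym (from∘to x)) px)
    (any? (P? ∘ from))

  ∀? : ∀ {P : Pred Carrier p} → P Respects _≈_ → Decidable P → Dec (∀ x → P x)
  ∀? resp P? = map′
    (λ all x → resp (from∘to x) (all (to x)))
    (λ all i → all (from i))
    (all? (P? ∘ from))

  vector : ∀ d → ≋-setoid S d HasSize (n ^ d)
  vector d = record
    { to        = λ v → funToFin (to ∘ v)
    ; from      = λ k → from ∘ finToFun k
    ; to-cong   = λ v≋w → funToFin-cong (λ i → to-cong (v≋w i))
    ; from-cong = λ { ≡.refl i → refl }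
    ; inverse   =
        (λ {k} {v} v≋k → ≡.trans
          (funToFin-cong (λ i → inverseˡ (v≋k i)))
          (funToFin-finToFin {d} {n} k)) ,
        (λ { {v} ≡.refl i → inverseʳ (finToFun-funToFin (to ∘ v) i) })
    }
    where
    funToFin-cong : ∀ {d m} {f g : Fin d → Fin m} → (∀ i → f i ≡ g i) → funToFin f ≡ funToFin g
    funToFin-cong {zero}  f≗g = ≡.refl
    funToFin-cong {suc d} f≗g = ≡.cong₂ combine (f≗g zero) (funToFin-cong (f≗g ∘ suc))

  -- `T` is the image of the part of `S` where `P` holds. The last hypothesis quantifies over every
  -- `y ≈ x` and every proof of `P y` because the search meets `x` only through its representative
  -- `from (to x)`, with a proof that it finds itself.
  finiteSubquotient : (T : Setoid s₂ ℓ₂) → Decidable₂ (Setoid._≈_ T) →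
    {P : Pred Carrier p} → P Respects _≈_ → Decidable P →
    (f : ∀ x → P x → Setoid.Carrier T) →
    (∀ t → ∃[ x ] P x × (∀ y → x ≈ y → (py : P y) → Setoid._≈_ T (f y py) t)) →
    ∃[ k ] T HasSize k
  finiteSubquotient T _≟ᵀ_ resp P? f cover =
    let (_ , g , g-cover) = filter (P? ∘ from) in
    finiteQuotient T _≟ᵀ_ (λ j → f (from (proj₁ (g j))) (proj₂ (g j)))
      λ t → let (x , px , fx≈t) = cover t
                (j , gj≡tox)    = g-cover {to x} (resp (sym (from∘to x)) px)
            in j , fx≈t _ (sym (trans (from-cong gj≡tox) (from∘to x))) (proj₂ (g j))

-- Deciding isomorphism of finite groups

module _ (A : Group 0ℓ 0ℓ) (B : Group s₁ ℓ₁) where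
  private
    module A = Group A
    module B = Group B
  open GroupMorphisms A.rawGroup B.rawGroup

  -- Up to pointwise equality, a map respecting `≈` between the two groups is a table
  -- `Fin m → Fin n`, coded by a number below `n ^ m`, so trying all tables settles the question.
  ≅-dec : ∀ {m n} → A.setoid HasSize m → B.setoid HasSize n → Dec (A ≅ B)
  ≅-dec {m} {n} A↔m B↔n = map′
    (λ (k , iso) → _ , iso)
    (λ (f , iso) → funToFin (Bₑ.to ∘ f ∘ Aₑ.from) ,
      ≈-resp-iso (λ x → B.sym (B.trans
        (Bₑ.from-cong (finToFun-funToFin (Bₑ.to ∘ f ∘ Aₑ.from) (Aₑ.to x)))
        (B.trans (Bₑ.strictlyInverseʳ _)
          (IsGroupIsomorphism.⟦⟧-cong iso (Aₑ.strictlyInverseʳ x))))) iso)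
    (any? (λ k → isIso? (finToFun k)))
    where
    module Aₑ = Inverse A↔m
    module Bₑ = Inverse B↔n
    module FA = Finite A↔m
    module FB = Finite B↔n

    extend : (Fin m → Fin n) → A.Carrier → B.Carrier
    extend f = Bₑ.from ∘ f ∘ Aₑ.to

    ≈-resp-iso : ∀ {f g} → (∀ x → f x B.≈ g x) → IsGroupIsomorphism f → IsGroupIsomorphism g
    ≈-resp-iso {f} {g} f≈g iso = record
      { isGroupMonomorphism = record
        { isGroupHomomorphism = record
          { isMonoidHomomorphism = record
            { isMagmaHomomorphism = record
              { isRelHomomorphism = record
                { cong = λ x≈y → B.trans (g≈f _) (B.trans (⟦⟧-cong x≈y) (f≈g _)) }
              ; homo = λ x y → B.trans (g≈f _) (B.trans (∙-homo x y) (B.∙-cong (f≈g x) (f≈g y)))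
              }
            ; ε-homo = B.trans (g≈f _) ε-homo
            }
          ; ⁻¹-homo = λ x → B.trans (g≈f _) (B.trans (⁻¹-homo x) (B.⁻¹-cong (f≈g x)))
          }
        ; injective = λ gx≈gy → injective (B.trans (f≈g _) (B.trans gx≈gy (g≈f _)))
        }
      ; surjective = λ y → proj₁ (surjective y) ,
          λ z≈x → B.trans (g≈f _) (proj₂ (surjective y) z≈x)
      }
      where
      open IsGroupIsomorphism iso
      g≈f : ∀ x → g x B.≈ f x
      g≈f x = B.sym (f≈g x)

    -- Congruence is not searched for, since `extend f` factors through `Aₑ.to`. It also lets every
    -- remaining law be tested on representatives.
    isIso? : ∀ f → Dec (IsGroupIsomorphism (extend f))
    isIso? f = map′
      (λ (homo , ε-homo , ⁻¹-homo , injective , surjective) → record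
        { isGroupMonomorphism = record
          { isGroupHomomorphism = record
            { isMonoidHomomorphism = record
              { isMagmaHomomorphism = record
                { isRelHomomorphism = record { cong = cong }
                ; homo = homo
                }
              ; ε-homo = ε-homo
              }
            ; ⁻¹-homo = ⁻¹-homo
            }
          ; injective = λ {x} {y} → injective x y
          }
        ; surjective = λ y → proj₁ (surjective y) ,
            λ z≈x → B.trans (cong z≈x) (proj₂ (surjective y))
        })
      (λ iso → let open IsGroupIsomorphism iso in
        ∙-homo , ε-homo , ⁻¹-homo , (λ x y → injective) ,
        λ y → proj₁ (surjective y) , proj₂ (surjective y) A.refl)
      (FA.∀? (λ x≈x′ h y → B.trans (cong (A.∙-cong (A.sym x≈x′) A.refl)) (B.trans (h y) (B.∙-cong (cong x≈x′) B.refl)))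
        (λ x → FA.∀? (λ y≈y′ h → B.trans (cong (A.∙-cong A.refl (A.sym y≈y′))) (B.trans h (B.∙-cong B.refl (cong y≈y′))))
          (λ y → g (x A.∙ y) FB.≟ (g x B.∙ g y)))
      ×-dec (g A.ε FB.≟ B.ε)
      ×-dec FA.∀? (λ x≈x′ h → B.trans (cong (A.⁻¹-cong (A.sym x≈x′))) (B.trans h (B.⁻¹-cong (cong x≈x′))))
          (λ x → g (x A.⁻¹) FB.≟ (g x B.⁻¹))
      ×-dec FA.∀? (λ x≈x′ h y gx′≈gy → A.trans (A.sym x≈x′) (h y (B.trans (cong x≈x′) gx′≈gy)))
          (λ x → FA.∀? (λ y≈y′ h gx≈gy′ → A.trans (h (B.trans gx≈gy′ (cong (A.sym y≈y′)))) y≈y′)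
            (λ y → (g x FB.≟ g y) →-dec (x FA.≟ y)))
      ×-dec FB.∀? (λ y≈y′ (x , gx≈y) → x , B.trans gx≈y y≈y′)
          (λ y → FA.∃? (λ x≈x′ gx≈y → B.trans (cong (A.sym x≈x′)) gx≈y) (λ x → g x FB.≟ y)))
      where
      g = extend f
      cong : ∀ {x y} → x A.≈ y → g x B.≈ g y
      cong x≈y = Bₑ.from-cong (≡.cong f (Aₑ.to-cong x≈y))

-- Linear combinations, spans and bases over a ring

module Kronecker (R : Ring 0ℓ 0ℓ) where
  open Ring R using (Carrier; _≈_; refl; 0#; 1#)

  -- Recursion on the index follows the recursion of `sum`, which makes `lincomb-δ` a direct
  -- induction.
  δ : ∀ {n} → Fin n → Vector Carrier n
  δ zero    = 1# ∷ λ _ → 0#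
  δ (suc i) = 0# ∷ δ i

  δ-sym : ∀ {n} (i j : Fin n) → δ i j ≈ δ j i
  δ-sym zero    zero    = refl
  δ-sym zero    (suc j) = refl
  δ-sym (suc i) zero    = refl
  δ-sym (suc i) (suc j) = δ-sym i j

  δ-diag : ∀ {n} (i : Fin n) → δ i i ≈ 1#
  δ-diag zero    = refl
  δ-diag (suc i) = δ-diag i

module LincombProperties {R : Ring 0ℓ 0ℓ} (M : LeftModule R 0ℓ 0ℓ) where
  private
    module R = Ring R
  open LeftModule M
  open LinearAlgebra M
  open LinearAlgebra (regularModule {R = R}) using () renaming (lincomb to ∑)
  open CommutativeMonoidSum +ᴹ-commutativeMonoid using (sum-cong-≋; ∑-distrib-+)
  open LeftModuleMorphisms rawLeftModule rawLeftModule
  open LeftModuleProperties M using (inverseˡ-uniqueᴹ)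
  open Kronecker R
  open SetoidReasoning ≈ᴹ-setoid
  open RingProperties R using (-1*x≈-x)
  open GroupProperties R.+-group using (x∙y⁻¹≈ε⇒x≈y)

  private
    variable
      n : ℕ
      a b : Vector R.Carrier n
      v w : Vector Carrierᴹ n

  lincomb-cong : (∀ i → a i R.≈ b i) → (∀ i → v i ≈ᴹ w i) → lincomb a v ≈ᴹ lincomb b w
  lincomb-cong a≈b v≈w = sum-cong-≋ (λ i → *ₗ-cong (a≈b i) (v≈w i))

  lincomb-congˡ : (∀ i → a i R.≈ b i) → lincomb a v ≈ᴹ lincomb b v
  lincomb-congˡ a≈b = lincomb-cong a≈b (λ _ → ≈ᴹ-refl)

  lincomb-congʳ : (∀ i → v i ≈ᴹ w i) → lincomb a v ≈ᴹ lincomb a w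
  lincomb-congʳ v≈w = lincomb-cong (λ _ → R.refl) v≈w

  lincomb-+ : ∀ (a b : Vector R.Carrier n) v →
    lincomb (λ i → a i R.+ b i) v ≈ᴹ lincomb a v +ᴹ lincomb b v
  lincomb-+ a b v = ≈ᴹ-trans
    (sum-cong-≋ (λ i → *ₗ-distribʳ (v i) (a i) (b i)))
    (∑-distrib-+ (λ i → a i *ₗ v i) (λ i → b i *ₗ v i))

  lincomb-* : ∀ c (a : Vector R.Carrier n) v → lincomb (λ i → c R.* a i) v ≈ᴹ c *ₗ lincomb a v
  lincomb-* {zero}  c a v = ≈ᴹ-sym (*ₗ-zeroʳ c)
  lincomb-* {suc n} c a v = ≈ᴹ-trans
    (+ᴹ-cong (*ₗ-assoc _ _ _) (lincomb-* c (a ∘ suc) (v ∘ suc)))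
    (≈ᴹ-sym (*ₗ-distribˡ _ _ _))

  lincomb-0 : (∀ i → a i R.≈ R.0#) → lincomb a v ≈ᴹ 0ᴹ
  lincomb-0 {zero}  a≈0 = ≈ᴹ-refl
  lincomb-0 {suc n} a≈0 = ≈ᴹ-trans
    (+ᴹ-cong (≈ᴹ-trans (*ₗ-congʳ (a≈0 zero)) (*ₗ-zeroˡ _)) (lincomb-0 (a≈0 ∘ suc)))
    (+ᴹ-identityˡ 0ᴹ)

  lincomb-δ : ∀ (i : Fin n) v → lincomb (δ i) v ≈ᴹ v i
  lincomb-δ zero v = ≈ᴹ-trans
    (+ᴹ-cong (*ₗ-identityˡ _) (lincomb-0 {v = v ∘ suc} (λ _ → R.refl))) (+ᴹ-identityʳ _)
  lincomb-δ (suc i) v = ≈ᴹ-trans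
    (+ᴹ-cong (*ₗ-zeroˡ _) (lincomb-δ i (v ∘ suc))) (+ᴹ-identityˡ _)

  lincomb-split : ∀ m {n} (a : Vector R.Carrier (m + n)) v →
    lincomb a v ≈ᴹ lincomb (a ∘ (_↑ˡ n)) (v ∘ (_↑ˡ n)) +ᴹ lincomb (a ∘ (m ↑ʳ_)) (v ∘ (m ↑ʳ_))
  lincomb-split zero    a v = ≈ᴹ-sym (+ᴹ-identityˡ _)
  lincomb-split (suc m) a v = ≈ᴹ-trans
    (+ᴹ-congˡ (lincomb-split m (a ∘ suc) (v ∘ suc))) (≈ᴹ-sym (+ᴹ-assoc _ _ _))

  lincomb-++ˡ : ∀ {m n} (a : Vector R.Carrier m) (b : Vector R.Carrier n) v →
    lincomb (a ++ b) v ≈ᴹ lincomb a (v ∘ (_↑ˡ n)) +ᴹ lincomb b (v ∘ (m ↑ʳ_))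
  lincomb-++ˡ {m} a b v = ≈ᴹ-trans (lincomb-split m (a ++ b) v) (+ᴹ-cong
    (lincomb-congˡ (λ i → R.reflexive (lookup-++ˡ a b i)))
    (lincomb-congˡ (λ j → R.reflexive (lookup-++ʳ a b j))))

  lincomb-++ʳ : ∀ {m n} a (v : Vector Carrierᴹ m) (w : Vector Carrierᴹ n) →
    lincomb a (v ++ w) ≈ᴹ lincomb (a ∘ (_↑ˡ n)) v +ᴹ lincomb (a ∘ (m ↑ʳ_)) w
  lincomb-++ʳ {m} a v w = ≈ᴹ-trans (lincomb-split m a (v ++ w)) (+ᴹ-cong
    (lincomb-congʳ (λ i → ≈ᴹ-reflexive (lookup-++ˡ v w i)))
    (lincomb-congʳ (λ j → ≈ᴹ-reflexive (lookup-++ʳ v w j))))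

  -- Interchange of two finite sums: the new coefficients are the row `c` times the matrix `a`.
  lincomb-lincomb : ∀ {m n} (c : Vector R.Carrier m) (a : Fin m → Vector R.Carrier n) v →
    lincomb c (λ i → lincomb (a i) v) ≈ᴹ lincomb (λ j → ∑ c (λ i → a i j)) v
  lincomb-lincomb {zero}  c a v = ≈ᴹ-sym (lincomb-0 {v = v} (λ _ → R.refl))
  lincomb-lincomb {suc m} c a v = begin
    c zero *ₗ lincomb (a zero) v +ᴹ lincomb (c ∘ suc) (λ i → lincomb (a (suc i)) v)
      ≈⟨ +ᴹ-cong (≈ᴹ-sym (lincomb-* (c zero) (a zero) v)) (lincomb-lincomb (c ∘ suc) (a ∘ suc) v) ⟩
    lincomb (λ j → c zero R.* a zero j) v +ᴹ lincomb (λ j → ∑ (c ∘ suc) (λ i → a (suc i) j)) v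
      ≈⟨ lincomb-+ _ _ v ⟨
    lincomb (λ j → ∑ c (λ i → a i j)) v ∎

  lincomb-homo : ∀ {f} → IsLeftModuleHomomorphism f → ∀ (a : Vector R.Carrier n) v →
    f (lincomb a v) ≈ᴹ lincomb a (f ∘ v)
  lincomb-homo {zero}  hom a v = IsLeftModuleHomomorphism.0ᴹ-homo hom
  lincomb-homo {suc n} hom a v = ≈ᴹ-trans (+ᴹ-homo _ _)
    (+ᴹ-cong (*ₗ-homo (a zero) (v zero)) (lincomb-homo hom (a ∘ suc) (v ∘ suc)))
    where open IsLeftModuleHomomorphism hom

  -- Independence applied to the difference, taken as `a + (- 1) * b` so that `lincomb-+` and
  -- `lincomb-*` evaluate it.
  coefficients-unique : LinearlyIndependent v → lincomb a v ≈ᴹ lincomb b v → ∀ i → a i R.≈ b i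
  coefficients-unique {v = v} {a = a} {b = b} indep av≈bv i = x∙y⁻¹≈ε⇒x≈y _ _ (R.trans
    (R.+-congˡ (R.sym (-1*x≈-x (b i))))
    (indep (λ j → a j R.+ R.- R.1# R.* b j) (begin
      lincomb (λ j → a j R.+ R.- R.1# R.* b j) v   ≈⟨ lincomb-+ a _ v ⟩
      lincomb a v +ᴹ lincomb (λ j → R.- R.1# R.* b j) v
        ≈⟨ +ᴹ-cong av≈bv (lincomb-* _ b v) ⟩
      lincomb b v +ᴹ (R.- R.1#) *ₗ lincomb b v     ≈⟨ +ᴹ-congʳ (*ₗ-identityˡ _) ⟨
      R.1# *ₗ lincomb b v +ᴹ (R.- R.1#) *ₗ lincomb b v  ≈⟨ *ₗ-distribʳ _ _ _ ⟨
      (R.1# R.+ R.- R.1#) *ₗ lincomb b v           ≈⟨ *ₗ-congʳ (R.-‿inverseʳ R.1#) ⟩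
      R.0# *ₗ lincomb b v                          ≈⟨ *ₗ-zeroˡ _ ⟩
      0ᴹ                                           ∎) i))

  LinearlyIndependent-cong : (∀ i → v i ≈ᴹ w i) → LinearlyIndependent v → LinearlyIndependent w
  LinearlyIndependent-cong v≈w indep a aw≈0 = indep a (≈ᴹ-trans (lincomb-congʳ v≈w) aw≈0)

  open Subspace

  lincomb-∈ : (U : Subspace) → (∀ i → member U (v i)) → ∀ a → member U (lincomb a v)
  lincomb-∈ {zero}  U v∈U a = 0-closed U
  lincomb-∈ {suc n} U v∈U a = +-closed U (*ₗ-closed U (a zero) (v∈U zero)) (lincomb-∈ U (v∈U ∘ suc) (a ∘ suc))

  span-⊆ : (U : Subspace) → (∀ i → member U (v i)) → member (span v) ⊆ member U
  span-⊆ U v∈U (a , av≈x) = ≈-closed U av≈x (lincomb-∈ U v∈U a)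

  ∈-span : ∀ (v : Vector Carrierᴹ n) i → member (span v) (v i)
  ∈-span v i = δ i , lincomb-δ i v

  span-cong : (∀ i → v i ≈ᴹ w i) → member (span v) ≐ member (span w)
  span-cong v≈w =
    (λ (a , av≈x) → a , ≈ᴹ-trans (lincomb-congʳ (λ i → ≈ᴹ-sym (v≈w i))) av≈x) ,
    (λ (a , aw≈x) → a , ≈ᴹ-trans (lincomb-congʳ v≈w) aw≈x)

  module _ {G : Group 0ℓ 0ℓ} (act : LinearAction G) where
    open LinearAction act

    image-span : ∀ g (v : Vector Carrierᴹ n) → member (image act g (span v)) ≐ member (span (λ i → g · v i))
    image-span g v =
      (λ (x , (a , av≈x) , gx≈y) → a ,
        ≈ᴹ-trans (≈ᴹ-sym (lincomb-homo (isHomomorphism g) a v)) (≈ᴹ-trans (·-cong (Group.refl G) av≈x) gx≈y)) ,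
      (λ (a , agv≈y) → lincomb a v , (a , ≈ᴹ-refl) , ≈ᴹ-trans (lincomb-homo (isHomomorphism g) a v) agv≈y)

  -- The scalar `- 1` provides the inverse. This allows a generator to be replaced by its negative.
  -ᴹ-closed : (U : Subspace) → ∀ {x} → member U x → member U (-ᴹ x)
  -ᴹ-closed U {x} x∈U = ≈-closed U (inverseˡ-uniqueᴹ _ _ (begin
    (R.- R.1#) *ₗ x +ᴹ x             ≈⟨ +ᴹ-congˡ (*ₗ-identityˡ x) ⟨
    (R.- R.1#) *ₗ x +ᴹ R.1# *ₗ x     ≈⟨ *ₗ-distribʳ x _ _ ⟨
    (R.- R.1# R.+ R.1#) *ₗ x         ≈⟨ *ₗ-congʳ (R.-‿inverseˡ R.1#) ⟩
    R.0# *ₗ x                        ≈⟨ *ₗ-zeroˡ x ⟩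
    0ᴹ                               ∎)) (*ₗ-closed U (R.- R.1#) x∈U)

  module Extension {Y : Vector Carrierᴹ n} (Y-basis : IsBasis Y) where

    coordinates : Carrierᴹ → Vector R.Carrier n
    coordinates x = proj₁ (proj₂ Y-basis x)

    lincomb-coordinates : ∀ x → lincomb (coordinates x) Y ≈ᴹ x
    lincomb-coordinates x = proj₂ (proj₂ Y-basis x)

    coordinates-lincomb : ∀ {x} a → lincomb a Y ≈ᴹ x → ∀ i → coordinates x i R.≈ a i
    coordinates-lincomb {x} a aY≈x = coefficients-unique (proj₁ Y-basis)
      (≈ᴹ-trans (lincomb-coordinates x) (≈ᴹ-sym aY≈x))

    extend : Vector Carrierᴹ n → Carrierᴹ → Carrierᴹ
    extend P x = lincomb (coordinates x) P

    -- Uniqueness of coefficients frees `extend` from the chosen `coordinates`: any expression of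
    -- `x` in the basis may be used. Congruence and linearity then follow by exhibiting a suitable
    -- expression.
    extend-lincomb : ∀ P {x} a → lincomb a Y ≈ᴹ x → extend P x ≈ᴹ lincomb a P
    extend-lincomb P a aY≈x = lincomb-congˡ (coordinates-lincomb a aY≈x)

    extend-basis : ∀ P i → extend P (Y i) ≈ᴹ P i
    extend-basis P i = ≈ᴹ-trans (extend-lincomb P (δ i) (lincomb-δ i Y)) (lincomb-δ i P)

    extend-homo : ∀ P → IsLeftModuleHomomorphism (extend P)
    extend-homo P = record
      { +ᴹ-isGroupHomomorphism = record
        { isMonoidHomomorphism = record
          { isMagmaHomomorphism = record
            { isRelHomomorphism = record
              { cong = λ {x} {y} x≈y → extend-lincomb P _ (≈ᴹ-trans (lincomb-coordinates y) (≈ᴹ-sym x≈y)) }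
            ; homo = +-homo
            }
          ; ε-homo = 0-homo
          }
        ; ⁻¹-homo = λ x → inverseˡ-uniqueᴹ _ _ (begin
            extend P (-ᴹ x) +ᴹ extend P x  ≈⟨ +-homo (-ᴹ x) x ⟨
            extend P (-ᴹ x +ᴹ x)
              ≈⟨ extend-lincomb P (λ _ → R.0#) (≈ᴹ-trans (lincomb-0 {v = Y} (λ _ → R.refl)) (≈ᴹ-sym (-ᴹ‿inverseˡ x))) ⟩
            lincomb (λ _ → R.0#) P         ≈⟨ lincomb-0 {v = P} (λ _ → R.refl) ⟩
            0ᴹ                             ∎)
        }
      ; *ₗ-homo = λ c x → ≈ᴹ-trans
          (extend-lincomb P _ (≈ᴹ-trans (lincomb-* c _ Y) (*ₗ-congˡ (lincomb-coordinates x))))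
          (lincomb-* c _ P)
      }
      where
      +-homo : ∀ x y → extend P (x +ᴹ y) ≈ᴹ extend P x +ᴹ extend P y
      +-homo x y = ≈ᴹ-trans
        (extend-lincomb P _ (≈ᴹ-trans (lincomb-+ _ _ Y) (+ᴹ-cong (lincomb-coordinates x) (lincomb-coordinates y))))
        (lincomb-+ _ _ P)

      0-homo : extend P 0ᴹ ≈ᴹ 0ᴹ
      0-homo = ≈ᴹ-trans (extend-lincomb P (λ _ → R.0#) (lincomb-0 {v = Y} (λ _ → R.refl))) (lincomb-0 {v = P} (λ _ → R.refl))

    homo-unique : ∀ {f g} → IsLeftModuleHomomorphism f → IsLeftModuleHomomorphism g →
      (∀ i → f (Y i) ≈ᴹ g (Y i)) → ∀ x → f x ≈ᴹ g x
    homo-unique {f} {g} f-homo g-homo fY≈gY x = begin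
      f x                                ≈⟨ F.⟦⟧-cong (lincomb-coordinates x) ⟨
      f (lincomb (coordinates x) Y)      ≈⟨ lincomb-homo f-homo _ Y ⟩
      lincomb (coordinates x) (f ∘ Y)    ≈⟨ lincomb-congʳ fY≈gY ⟩
      lincomb (coordinates x) (g ∘ Y)    ≈⟨ lincomb-homo g-homo _ Y ⟨
      g (lincomb (coordinates x) Y)      ≈⟨ G.⟦⟧-cong (lincomb-coordinates x) ⟩
      g x                                ∎
      where
      module F = IsLeftModuleHomomorphism f-homo
      module G = IsLeftModuleHomomorphism g-homo

  mutuallyInverse⇒automorphism : ∀ {f g : Carrierᴹ → Carrierᴹ} → IsLeftModuleHomomorphism f →
    (∀ {x y} → x ≈ᴹ y → g x ≈ᴹ g y) → (∀ x → g (f x) ≈ᴹ x) → (∀ x → f (g x) ≈ᴹ x) → Automorphism M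
  mutuallyInverse⇒automorphism {f} {g} f-homo g-cong gf fg = record
    { to = f
    ; isIso = record
      { isLeftModuleMonomorphism = record
        { isLeftModuleHomomorphism = f-homo
        ; injective = λ {x} {y} fx≈fy → ≈ᴹ-trans (≈ᴹ-sym (gf x)) (≈ᴹ-trans (g-cong fx≈fy) (gf y))
        }
      ; surjective = λ y → g y , λ z≈gy → ≈ᴹ-trans (IsLeftModuleHomomorphism.⟦⟧-cong f-homo z≈gy) (fg y)
      }
    }

module _ (R : CommutativeRing 0ℓ 0ℓ) where
  open CommutativeRing R
  open LinearAlgebra (regularModule {R = ring})

  -- Combinations over `F` in `K` are computed by multiplying in `K`, so exchanging the factors
  -- turns an `F`-combination of the entries of `(1, u)` into a `K`-combination with coefficients
  -- `(1, u)`.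
  lincomb-comm : ∀ {d} (c x : Vector Carrier d) → lincomb c x ≈ lincomb x c
  lincomb-comm {zero}  c x = refl
  lincomb-comm {suc d} c x = +-cong (*-comm _ _) (lincomb-comm (c ∘ suc) (x ∘ suc))

↑-elim : ∀ {p} m {n} (P : Pred (Fin (m + n)) p) →
         (∀ i → P (i ↑ˡ n)) → (∀ j → P (m ↑ʳ j)) → ∀ k → P k
↑-elim m {n} P left right k with splitAt m k in eq
... | inj₁ i = ≡.subst P (splitAt⁻¹-↑ˡ eq) (left i)
... | inj₂ j = ≡.subst P (splitAt⁻¹-↑ʳ eq) (right j)

-- Equivalence of the subspaces `T u` under linear automorphisms of `V`

module Orbits {F K : CommutativeRing 0ℓ 0ℓ}
  (ι : RingHomomorphism (CommutativeRing.rawRing F) (CommutativeRing.rawRing K))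
  (V : LeftModule (CommutativeRing.ring K) 0ℓ 0ℓ)
  {r s n : ℕ} (1≤r : 1 ≤ r) {Y : Vector (LeftModule.Carrierᴹ V) (r + (s + n))}
  (Y-basis : LinearAlgebra.IsBasis V Y)
  where

  private
    module F = CommutativeRing F
    module K = CommutativeRing K
    open RingHomomorphism ι using (⟦_⟧; ⟦⟧-cong; +-homo; 0#-homo)
    open LeftModule V
    open LeftModuleMorphisms rawLeftModule rawLeftModule using (module IsLeftModuleHomomorphism; IsLeftModuleHomomorphism)
    open IsLeftModuleHomomorphism using (0ᴹ-homo; -ᴹ-homo) renaming (⟦⟧-cong to homo-cong)
    module V-module = LeftModuleProperties V

    F/F : LeftModule F.ring 0ℓ 0ℓ
    F/F = regularModule

    K/K : LeftModule K.ring 0ℓ 0ℓ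
    K/K = regularModule

    K/F : LeftModule F.ring 0ℓ 0ℓ
    K/F = restrictScalars F.ring K.ring ι K/K

    V/F : LeftModule F.ring 0ℓ 0ℓ
    V/F = restrictScalars F.ring K.ring ι V

    module F/F where
      open LinearAlgebra F/F public
      open LincombProperties F/F public
    module K/K where
      open LinearAlgebra K/K public
      open LincombProperties K/K public
    module K/F where
      open LinearAlgebra K/F public
      open LincombProperties K/F public
    module V/F where
      open LinearAlgebra V/F public
      open LincombProperties V/F public
    module V where
      open LinearAlgebra V public
      open LincombProperties V public
      open Extension Y-basis public

    open Kronecker F.ring
    open V/F.Subspace

  private
    variable
      u u′ : Vector K.Carrier r

  -- The basis in three blocks, with `k - 1 = r + s`: `A` enters the sum `Σ u_i Y_i`, `B` consists
  -- of the remaining `Y_i` in `T u`, and `C` completes the basis.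
  A : Vector Carrierᴹ r
  A = Y ∘ (_↑ˡ (s + n))

  B : Vector Carrierᴹ s
  B j = Y (r ↑ʳ (j ↑ˡ n))

  C : Vector Carrierᴹ n
  C j = Y (r ↑ʳ (s ↑ʳ j))

  Matrix : Set
  Matrix = Fin (suc r) → Vector F.Carrier (suc r)

  -- The sign makes ⟨1, u⟩ the coefficients of the K-linear relation satisfied by
  -- the generators.
  generators : Vector K.Carrier r → Vector Carrierᴹ (suc r)
  generators u = -ᴹ V.lincomb u A ∷ A

  T : Vector K.Carrier r → V/F.Subspace
  T u = V/F.span (generators u ++ B)

  LI : Pred (Vector K.Carrier r) 0ℓ
  LI u = K/F.LinearlyIndependent (K.1# ∷ u)

  -- For the matrix `M` with `M_ij = a j i` this is `e(u) M = κ e(u′)`, so it records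
  -- `κ⟨1, u′⟩ ⊆ ⟨1, u⟩`; the reverse inclusion takes a second matrix.
  Scales : Vector K.Carrier r → Vector K.Carrier r → K.Carrier → Pred Matrix 0ℓ
  Scales u u′ κ a = ∀ j → K/F.lincomb (a j) (K.1# ∷ u) K.≈ κ K.* (K.1# ∷ u′) j

  generators-relation : ∀ u → V.lincomb (K.1# ∷ u) (generators u) ≈ᴹ 0ᴹ
  generators-relation u = ≈ᴹ-trans (+ᴹ-congʳ (*ₗ-identityˡ _)) (-ᴹ‿inverseˡ _)

  -- Writing out the first generator as `-ᴹ V.lincomb u A` turns the relation into one among the
  -- basis vectors, with coefficients `c_i - c_0 u_i` on `A`, those of `c` on `B`, and zero on `C`.
  -- All of them vanish.
  relation-unique : ∀ u (c : Vector K.Carrier (suc r + s)) → V.lincomb c (generators u ++ B) ≈ᴹ 0ᴹ →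
    (∀ i → c (i ↑ˡ s) K.≈ c zero K.* (K.1# ∷ u) i) × (∀ j → c (suc r ↑ʳ j) K.≈ K.0#)
  relation-unique u c c-relation =
    (λ { zero → K.sym (K.*-identityʳ _)
       ; (suc i) → x∙y⁻¹≈ε⇒x≈y _ _ (K.trans
           (K.+-congˡ (-‿distribˡ-* _ _))
           (K.trans (K.reflexive (≡.sym (lookup-++ˡ x (y ++ z) i))) (xyz≈0 (i ↑ˡ (s + n)))))
       }) ,
    λ j → K.trans
      (K.reflexive (≡.trans (≡.sym (lookup-++ˡ y z j)) (≡.sym (lookup-++ʳ x (y ++ z) (j ↑ˡ n)))))
      (xyz≈0 (r ↑ʳ (j ↑ˡ n)))
    where
    open RingProperties K.ring using (-‿distribˡ-*)
    open GroupProperties K.+-group using (x∙y⁻¹≈ε⇒x≈y)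
    open SetoidReasoning ≈ᴹ-setoid

    c₀ = c zero
    c₁ : Vector K.Carrier r
    c₁ i = c (suc i ↑ˡ s)
    x : Vector K.Carrier r
    x i = c₁ i K.+ (K.- c₀) K.* u i
    y : Vector K.Carrier s
    y j = c (suc r ↑ʳ j)
    z : Vector K.Carrier n
    z _ = K.0#

    xyz≈0 : ∀ i → (x ++ (y ++ z)) i K.≈ K.0#
    xyz≈0 = proj₁ Y-basis (x ++ (y ++ z)) (begin
      V.lincomb (x ++ (y ++ z)) Y                    ≈⟨ V.lincomb-++ˡ x (y ++ z) Y ⟩
      V.lincomb x A +ᴹ V.lincomb (y ++ z) (Y ∘ (r ↑ʳ_))
        ≈⟨ +ᴹ-cong (V.lincomb-+ c₁ _ A) (V.lincomb-++ˡ y z (Y ∘ (r ↑ʳ_))) ⟩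
      V.lincomb c₁ A +ᴹ V.lincomb (λ i → (K.- c₀) K.* u i) A +ᴹ (V.lincomb y B +ᴹ V.lincomb z C)
        ≈⟨ +ᴹ-cong (+ᴹ-comm _ _) (≈ᴹ-trans (+ᴹ-congˡ (V.lincomb-0 {v = C} (λ _ → K.refl))) (+ᴹ-identityʳ _)) ⟩
      V.lincomb (λ i → (K.- c₀) K.* u i) A +ᴹ V.lincomb c₁ A +ᴹ V.lincomb y B
        ≈⟨ +ᴹ-congʳ (+ᴹ-congʳ (≈ᴹ-trans (V.lincomb-* (K.- c₀) u A) neg)) ⟩
      V.lincomb (c ∘ (_↑ˡ s)) (generators u) +ᴹ V.lincomb y B
        ≈⟨ V.lincomb-++ʳ c (generators u) B ⟨
      V.lincomb c (generators u ++ B)                ≈⟨ c-relation ⟩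
      0ᴹ                                             ∎)
      where
      neg : (K.- c₀) *ₗ V.lincomb u A ≈ᴹ c₀ *ₗ (-ᴹ V.lincomb u A)
      neg = ≈ᴹ-trans
        (V-module.inverseˡ-uniqueᴹ _ _ (≈ᴹ-trans (≈ᴹ-sym (*ₗ-distribʳ _ _ _))
          (≈ᴹ-trans (*ₗ-congʳ (K.-‿inverseˡ c₀)) (*ₗ-zeroˡ _))))
        (≈ᴹ-sym (V-module.inverseˡ-uniqueᴹ _ _ (≈ᴹ-trans (≈ᴹ-sym (*ₗ-distribˡ _ _ _))
          (≈ᴹ-trans (*ₗ-congˡ (-ᴹ‿inverseˡ _)) (*ₗ-zeroʳ _)))))

  -- An `F`-relation `a` is also a `K`-relation, hence proportional to `(1, u)`: `a_i = a_0 u_i` for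
  -- each `i ≥ 1`. Since the `a_i` lie in `F`, this is an `F`-relation between `1` and `u_i`, and
  -- its coefficients `a_i` and `- a_0` vanish.
  generators-independent : LI u → V/F.LinearlyIndependent (generators u)
  generators-independent {u} u-indep a au≈0 =
    λ { zero → a₀≈0 ; (suc i) → proj₁ (vanish i) }
    where
    c : Vector K.Carrier (suc r + s)
    c = (⟦_⟧ ∘ a) ++ λ _ → K.0#

    c-proportional : ∀ i → ⟦ a i ⟧ K.≈ ⟦ a zero ⟧ K.* (K.1# ∷ u) i
    c-proportional i = K.trans
      (K.reflexive (≡.sym (lookup-++ˡ (⟦_⟧ ∘ a) (λ _ → K.0#) i)))
      (proj₁ (relation-unique u c (≈ᴹ-trans (V.lincomb-++ˡ (⟦_⟧ ∘ a) (λ _ → K.0#) (generators u ++ B))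
        (≈ᴹ-trans (+ᴹ-cong
          (≈ᴹ-trans (V.lincomb-congʳ {w = generators u} {a = ⟦_⟧ ∘ a} (λ i → ≈ᴹ-reflexive (lookup-++ˡ (generators u) B i))) au≈0)
          (V.lincomb-0 {v = (generators u ++ B) ∘ (suc r ↑ʳ_)} (λ _ → K.refl))) (+ᴹ-identityʳ 0ᴹ)))) i)

    vanish : ∀ i → a (suc i) F.≈ F.0# × (F.- a zero) F.* F.1# F.≈ F.0#
    vanish i = c′≈0 zero , F.trans (F.*-congˡ (F.sym (δ-diag i))) (c′≈0 (suc i))
      where
      open SetoidReasoning K.setoid
      -- The relation `a_i · 1 - a_0 u_i = 0`, padded by zeros through `δ i`.
      c′ : Vector F.Carrier (suc r)
      c′ = a (suc i) ∷ λ k → (F.- a zero) F.* δ i k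
      c′≈0 : ∀ k → c′ k F.≈ F.0#
      c′≈0 = u-indep c′ (begin
        ⟦ a (suc i) ⟧ K.* K.1# K.+ K/F.lincomb (λ k → (F.- a zero) F.* δ i k) u
          ≈⟨ K.+-cong (K.*-identityʳ _) (K/F.lincomb-* _ (δ i) u) ⟩
        ⟦ a (suc i) ⟧ K.+ ⟦ F.- a zero ⟧ K.* K/F.lincomb (δ i) u
          ≈⟨ K.+-cong (c-proportional (suc i)) (K.*-congˡ (K/F.lincomb-δ i u)) ⟩
        ⟦ a zero ⟧ K.* u i K.+ ⟦ F.- a zero ⟧ K.* u i
          ≈⟨ K.distribʳ _ _ _ ⟨
        (⟦ a zero ⟧ K.+ ⟦ F.- a zero ⟧) K.* u i
          ≈⟨ K.*-congʳ (+-homo _ _) ⟨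
        ⟦ a zero F.+ F.- a zero ⟧ K.* u i
          ≈⟨ K.*-congʳ (K.trans (⟦⟧-cong (F.-‿inverseʳ _)) 0#-homo) ⟩
        K.0# K.* u i  ≈⟨ K.zeroˡ _ ⟩
        K.0# ∎)

    -- `1 ≤ r` supplies an entry of `u` at which to read off `- a_0 = 0`.
    a₀≈0 : a zero F.≈ F.0#
    a₀≈0 = F.trans (F.sym (⁻¹-involutive _))
      (F.trans (F.-‿cong (F.trans (F.sym (F.*-identityʳ _)) (proj₂ (vanish (fromℕ< 1≤r))))) ε⁻¹≈ε)
      where open GroupProperties F.+-group using (⁻¹-involutive; ε⁻¹≈ε)

  lincomb-homo/F : ∀ {f} → IsLeftModuleHomomorphism f → ∀ {d} (c : Vector F.Carrier d) v →
    f (V/F.lincomb c v) ≈ᴹ V/F.lincomb c (f ∘ v)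
  lincomb-homo/F f-homo c v = V.lincomb-homo f-homo (⟦_⟧ ∘ c) v

  -- Applying `f` to `e(u) · s(u) = 0` gives a `K`-relation among the generators of `T u′`. By
  -- `relation-unique` it is `κ` times `(1, u′)` on the first `r + 1` of them and zero on `B`. The
  -- `B` part says that elements of `F` combine `(1, u)` to zero, so these elements vanish and `f`
  -- maps `s(u)` into the `F`-span of `s(u′)`.
  homo⇒scales : ∀ {f} → IsLeftModuleHomomorphism f → LI u →
    (∀ i → member (T u′) (f (generators u i))) →
    ∃[ κ ] ∃[ a ] Scales u u′ κ a × (∀ i → f (generators u i) ≈ᴹ V/F.lincomb (λ j → a j i) (generators u′))
  homo⇒scales {u} {u′} {f} f-homo u-indep f∈T =
    c zero , a , scales , λ i → begin
      f (generators u i)                                   ≈⟨ proj₂ (f∈T i) ⟨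
      V/F.lincomb (x i) (generators u′ ++ B)               ≈⟨ V/F.lincomb-++ʳ (x i) (generators u′) B ⟩
      V/F.lincomb (λ j → a j i) (generators u′) +ᴹ V/F.lincomb (λ j → x i (suc r ↑ʳ j)) B
        ≈⟨ +ᴹ-congˡ (V/F.lincomb-0 {v = B} (λ j → x₂≈0 j i)) ⟩
      V/F.lincomb (λ j → a j i) (generators u′) +ᴹ 0ᴹ      ≈⟨ +ᴹ-identityʳ _ ⟩
      V/F.lincomb (λ j → a j i) (generators u′)            ∎
    where
    open SetoidReasoning ≈ᴹ-setoid
    x : Fin (suc r) → Vector F.Carrier (suc r + s)
    x i = proj₁ (f∈T i)

    c : Vector K.Carrier (suc r + s)
    c j = K/K.lincomb (K.1# ∷ u) (λ i → ⟦ x i j ⟧)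

    -- Transposed: row `j` collects the coefficients at generator `j` of all the images, as `Scales`
    -- requires.
    a : Matrix
    a j i = x i (j ↑ˡ s)

    c-relation : V.lincomb c (generators u′ ++ B) ≈ᴹ 0ᴹ
    c-relation = begin
      V.lincomb c (generators u′ ++ B)
        ≈⟨ V.lincomb-lincomb (K.1# ∷ u) (λ i → ⟦_⟧ ∘ x i) (generators u′ ++ B) ⟨
      V.lincomb (K.1# ∷ u) (λ i → V/F.lincomb (x i) (generators u′ ++ B))
        ≈⟨ V.lincomb-congʳ {a = K.1# ∷ u} (λ i → proj₂ (f∈T i)) ⟩
      V.lincomb (K.1# ∷ u) (f ∘ generators u)      ≈⟨ V.lincomb-homo f-homo (K.1# ∷ u) (generators u) ⟨
      f (V.lincomb (K.1# ∷ u) (generators u))      ≈⟨ homo-cong f-homo (generators-relation u) ⟩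
      f 0ᴹ                                         ≈⟨ 0ᴹ-homo f-homo ⟩
      0ᴹ                                           ∎

    scales : Scales u u′ (c zero) a
    scales j = K.trans (lincomb-comm K (⟦_⟧ ∘ a j) (K.1# ∷ u)) (proj₁ (relation-unique u′ c c-relation) j)

    x₂≈0 : ∀ j i → x i (suc r ↑ʳ j) F.≈ F.0#
    x₂≈0 j = u-indep (λ i → x i (suc r ↑ʳ j))
      (K.trans (lincomb-comm K (λ i → ⟦ x i (suc r ↑ʳ j) ⟧) (K.1# ∷ u)) (proj₂ (relation-unique u′ c c-relation) j))

  product : Matrix → Matrix → Matrix
  product b a k i = F/F.lincomb (b k) (λ j → a j i)

  -- Substituting one set of equations in the other multiplies both the matrices and the scalars.
  -- The scalar `κ` is taken out of the `F`-combination after its factors are exchanged.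
  scales-∘ : ∀ {u u′ κ α κ′ β} → Scales u u′ κ α → Scales u′ u κ′ β → Scales u u (κ K.* κ′) (product β α)
  scales-∘ {u} {u′} {κ} {α} {κ′} {β} u→u′ u′→u k = begin
    K/F.lincomb (product β α k) (K.1# ∷ u)
      ≈⟨ K/F.lincomb-lincomb (β k) α (K.1# ∷ u) ⟨
    K/F.lincomb (β k) (λ j → K/F.lincomb (α j) (K.1# ∷ u))
      ≈⟨ K/F.lincomb-congʳ {w = λ j → κ K.* (K.1# ∷ u′) j} {a = β k} u→u′ ⟩
    K/F.lincomb (β k) (λ j → κ K.* (K.1# ∷ u′) j)
      ≈⟨ lincomb-comm K (⟦_⟧ ∘ β k) (λ j → κ K.* (K.1# ∷ u′) j) ⟩
    K/K.lincomb (λ j → κ K.* (K.1# ∷ u′) j) (⟦_⟧ ∘ β k)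
      ≈⟨ K/K.lincomb-* κ (K.1# ∷ u′) (⟦_⟧ ∘ β k) ⟩
    κ K.* K/K.lincomb (K.1# ∷ u′) (⟦_⟧ ∘ β k)
      ≈⟨ K.*-congˡ (K.trans (lincomb-comm K (K.1# ∷ u′) (⟦_⟧ ∘ β k)) (u′→u k)) ⟩
    κ K.* (κ′ K.* (K.1# ∷ u) k)
      ≈⟨ K.*-assoc _ _ _ ⟨
    κ K.* κ′ K.* (K.1# ∷ u) k ∎
    where open SetoidReasoning K.setoid

  lincomb-product : ∀ {α β : Matrix} {v : Vector Carrierᴹ (suc r)} i →
    V/F.lincomb (λ j → α j i) (λ j → V/F.lincomb (λ k → β k j) v) ≈ᴹ V/F.lincomb (λ k → product β α k i) v
  lincomb-product {α} {β} {v} i = ≈ᴹ-trans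
    (V/F.lincomb-lincomb (λ j → α j i) (λ j k → β k j) v)
    (V/F.lincomb-congˡ {v = v} (λ k → lincomb-comm F (λ j → α j i) (β k)))

  -- The equality `κ⟨1, u′⟩ = ⟨1, u⟩` as two inclusions, with `κ′` the inverse of `κ`. That the two
  -- matrices are mutually inverse is derived later from the independence of `(1, u)` and `(1, u′)`.
  Equivalent : Vector K.Carrier r → Vector K.Carrier r → Set
  Equivalent u u′ = ∃[ κ ] ∃[ κ′ ] κ K.* κ′ K.≈ K.1# × ∃ (Scales u u′ κ) × ∃ (Scales u′ u κ′)

  module G = GroupAction (V/F.subspaceAction (restrictAction F.ring K.ring ι V (GL-action V)))

  generator∈T : ∀ u i → member (T u) (generators u i)
  generator∈T u i = ≈-closed (T u) (≈ᴹ-reflexive (lookup-++ˡ (generators u) B i))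
    (V/F.∈-span (generators u ++ B) (i ↑ˡ s))

  B∈T : ∀ u j → member (T u) (B j)
  B∈T u j = ≈-closed (T u) (≈ᴹ-reflexive (lookup-++ʳ (generators u) B j))
    (V/F.∈-span (generators u ++ B) (suc r ↑ʳ j))

  homo-T⊆T : ∀ {f} → IsLeftModuleHomomorphism f →
    (∀ i → member (T u′) (f (generators u i))) → (∀ j → f (B j) ≈ᴹ B j) →
    ∀ {x} → member (T u) x → member (T u′) (f x)
  homo-T⊆T {u′} {u} {f} f-homo f∈T fB≈B (c , c≈x) = ≈-closed (T u′)
    (≈ᴹ-trans (≈ᴹ-sym (lincomb-homo/F f-homo c (generators u ++ B))) (homo-cong f-homo c≈x))
    (V/F.lincomb-∈ (T u′)
      (↑-elim (suc r) (λ k → member (T u′) (f ((generators u ++ B) k)))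
        (λ i → ≈-closed (T u′) (homo-cong f-homo (≈ᴹ-reflexive (≡.sym (lookup-++ˡ (generators u) B i)))) (f∈T i))
        (λ j → ≈-closed (T u′)
          (≈ᴹ-trans (≈ᴹ-sym (fB≈B j)) (homo-cong f-homo (≈ᴹ-reflexive (≡.sym (lookup-++ʳ (generators u) B j)))))
          (B∈T u′ j)))
      c)

  -- `homo⇒scales` applies to the automorphism and to its inverse. The composite fixes the
  -- generators of `T u`, so the product of the matrices is the identity by
  -- `generators-independent`, and comparing scalars gives `κ κ′ = 1`.
  T∼T⇒equivalent : LI u → LI u′ → T u G.∼ T u′ → Equivalent u u′
  T∼T⇒equivalent {u} {u′} u-indep u′-indep (g , gT⊆T′ , T′⊆gT) =
    κ , κ′ , κκ′≈1 , (a , a-scales) , (b , b-scales)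
    where
    module g = Automorphism g
    module g⁻¹ = Automorphism (Group._⁻¹ (GL V) g)

    f = homo⇒scales {u} {u′} g.isLeftModuleHomomorphism u-indep
      (λ i → gT⊆T′ (generators u i , generator∈T u i , ≈ᴹ-refl))
    -- The inclusion of `T u′` in the image of `T u`, pulled back along `g`.
    f⁻¹ = homo⇒scales {u′} {u} g⁻¹.isLeftModuleHomomorphism u′-indep
      (λ i → let (x , x∈T , gx≈) = T′⊆gT (generator∈T u′ i) in
        ≈-closed (T u) (≈ᴹ-sym (g.from-unique gx≈)) x∈T)

    κ = proj₁ f
    κ′ = proj₁ f⁻¹
    a = proj₁ (proj₂ f)
    b = proj₁ (proj₂ f⁻¹)
    a-scales = proj₁ (proj₂ (proj₂ f))
    b-scales = proj₁ (proj₂ (proj₂ f⁻¹))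

    ba≈δ : ∀ i k → product b a k i F.≈ δ i k
    ba≈δ i = V/F.coefficients-unique {v = generators u} (generators-independent u-indep) (begin
      V/F.lincomb (λ k → product b a k i) (generators u)      ≈⟨ lincomb-product {a} {b} {generators u} i ⟨
      V/F.lincomb (λ j → a j i) (λ j → V/F.lincomb (λ k → b k j) (generators u))
        ≈⟨ V/F.lincomb-congʳ {a = λ j → a j i} (proj₂ (proj₂ (proj₂ f⁻¹))) ⟨
      V/F.lincomb (λ j → a j i) (g⁻¹.to ∘ generators u′)
        ≈⟨ lincomb-homo/F g⁻¹.isLeftModuleHomomorphism (λ j → a j i) (generators u′) ⟨
      g⁻¹.to (V/F.lincomb (λ j → a j i) (generators u′))
        ≈⟨ homo-cong g⁻¹.isLeftModuleHomomorphism (proj₂ (proj₂ (proj₂ f)) i) ⟨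
      g⁻¹.to (g.to (generators u i))                          ≈⟨ g.from-to _ ⟩
      generators u i                                          ≈⟨ V/F.lincomb-δ i (generators u) ⟨
      V/F.lincomb (δ i) (generators u)                        ∎)
      where open SetoidReasoning ≈ᴹ-setoid

    κκ′≈1 : κ K.* κ′ K.≈ K.1#
    κκ′≈1 = begin
      κ K.* κ′                                       ≈⟨ K.*-identityʳ _ ⟨
      -- Row `zero` suffices, where the entry of `(1, u)` is `1`.
      κ K.* κ′ K.* K.1#                              ≈⟨ scales-∘ {u} {u′} {κ} {a} {κ′} {b} a-scales b-scales zero ⟨
      K/F.lincomb (product b a zero) (K.1# ∷ u)
        ≈⟨ K/F.lincomb-congˡ {v = K.1# ∷ u} (λ i → F.trans (ba≈δ i zero) (δ-sym i zero)) ⟩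
      K/F.lincomb (δ zero) (K.1# ∷ u)                ≈⟨ K/F.lincomb-δ zero (K.1# ∷ u) ⟩
      K.1#                                           ∎
      where open SetoidReasoning K.setoid

  -- The linear map that should carry `generators u` to `combination`. Its values are prescribed on
  -- the basis, with `B` and `C` fixed, which forces its value at the zeroth generator;
  -- `combination-relation` shows that this is `combination zero`.
  module Induced (u u′ : Vector K.Carrier r) {κ : K.Carrier} {a : Matrix} (a-scales : Scales u u′ κ a) where

    combination : Vector Carrierᴹ (suc r)
    combination i = V/F.lincomb (λ j → a j i) (generators u′)

    values : Vector Carrierᴹ (r + (s + n))
    values = (combination ∘ suc) ++ (Y ∘ (r ↑ʳ_))

    φ : Carrierᴹ → Carrierᴹ
    φ = V.extend values

    φ-homo : IsLeftModuleHomomorphism φ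
    φ-homo = V.extend-homo values

    φ-tail : ∀ j → φ (Y (r ↑ʳ j)) ≈ᴹ Y (r ↑ʳ j)
    φ-tail j = ≈ᴹ-trans (V.extend-basis values (r ↑ʳ j))
      (≈ᴹ-reflexive (lookup-++ʳ (combination ∘ suc) (Y ∘ (r ↑ʳ_)) j))

    φ-A : ∀ i → φ (A i) ≈ᴹ combination (suc i)
    φ-A i = ≈ᴹ-trans (V.extend-basis values (i ↑ˡ (s + n)))
      (≈ᴹ-reflexive (lookup-++ˡ (combination ∘ suc) (Y ∘ (r ↑ʳ_)) i))

    -- With `M_ij = a j i`, `e(u) · M s(u′) = κ e(u′) · s(u′) = 0`: the intended images satisfy the
    -- same relation as the generators.
    combination-relation : V.lincomb (K.1# ∷ u) combination ≈ᴹ 0ᴹ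
    combination-relation = begin
      V.lincomb (K.1# ∷ u) combination
        ≈⟨ V.lincomb-lincomb (K.1# ∷ u) (λ i j → ⟦ a j i ⟧) (generators u′) ⟩
      V.lincomb (λ j → K/K.lincomb (K.1# ∷ u) (⟦_⟧ ∘ a j)) (generators u′)
        ≈⟨ V.lincomb-congˡ {v = generators u′} (λ j → K.trans (lincomb-comm K (K.1# ∷ u) (⟦_⟧ ∘ a j)) (a-scales j)) ⟩
      V.lincomb (λ j → κ K.* (K.1# ∷ u′) j) (generators u′)
        ≈⟨ V.lincomb-* κ (K.1# ∷ u′) (generators u′) ⟩
      κ *ₗ V.lincomb (K.1# ∷ u′) (generators u′)
        ≈⟨ *ₗ-congˡ (generators-relation u′) ⟩
      κ *ₗ 0ᴹ ≈⟨ *ₗ-zeroʳ κ ⟩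
      0ᴹ ∎
      where open SetoidReasoning ≈ᴹ-setoid

    φ-generators : ∀ i → φ (generators u i) ≈ᴹ combination i
    φ-generators (suc i) = φ-A i
    φ-generators zero = begin
      φ (-ᴹ V.lincomb u A)                        ≈⟨ -ᴹ-homo φ-homo _ ⟩
      -ᴹ φ (V.lincomb u A)                        ≈⟨ -ᴹ‿cong (V.lincomb-homo φ-homo u A) ⟩
      -ᴹ V.lincomb u (φ ∘ A)                      ≈⟨ -ᴹ‿cong (V.lincomb-congʳ {a = u} φ-A) ⟩
      -ᴹ V.lincomb u (combination ∘ suc)          ≈⟨ V-module.inverseˡ-uniqueᴹ _ _ combination-relation ⟨
      K.1# *ₗ combination zero                    ≈⟨ *ₗ-identityˡ _ ⟩
      combination zero                            ∎
      where open SetoidReasoning ≈ᴹ-setoid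

    φ-T : ∀ {x} → member (T u) x → member (T u′) (φ x)
    φ-T = homo-T⊆T {u′} {u} φ-homo
      (λ i → ≈-closed (T u′) (≈ᴹ-sym (φ-generators i))
        (V/F.lincomb-∈ (T u′) (generator∈T u′) (λ j → a j i)))
      (λ j → φ-tail (j ↑ˡ n))

  equivalent-sym : Equivalent u u′ → Equivalent u′ u
  equivalent-sym (κ , κ′ , κκ′≈1 , a , b) = κ′ , κ , K.trans (K.*-comm κ′ κ) κκ′≈1 , b , a

  -- The maps induced by the two matrices are inverse automorphisms, and each carries one subspace
  -- into the other.
  equivalent⇒T∼T : LI u → LI u′ → Equivalent u u′ → T u G.∼ T u′
  equivalent⇒T∼T {u} {u′} u-indep u′-indep u≈u′@(κ , κ′ , κκ′≈1 , (a , a-scales) , (b , b-scales)) =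
    V.mutuallyInverse⇒automorphism {f = φ} {g = ψ} φ-homo (homo-cong ψ-homo)
      (inverse u-indep u≈u′) (inverse u′-indep (equivalent-sym u≈u′)) ,
    (λ (x , x∈T , φx≈y) → ≈-closed (T u′) φx≈y (φ-T x∈T)) ,
    (λ {y} y∈T → ψ y , ψ-T y∈T , inverse u′-indep (equivalent-sym u≈u′) y)
    where
    open Induced u u′ {κ} {a} a-scales
    open Induced u′ u {κ′} {b} b-scales using () renaming (φ to ψ; φ-homo to ψ-homo; φ-T to ψ-T)

    -- Stated for every pair of parameters, so that both composites are instances.
    inverse : ∀ {u u′} → LI u →
      ((κ , κ′ , _ , (a , a-scales) , (b , b-scales)) : Equivalent u u′) →
      ∀ x → Induced.φ u′ u {κ′} {b} b-scales (Induced.φ u u′ {κ} {a} a-scales x) ≈ᴹ x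
    inverse {u} {u′} u-indep (κ , κ′ , κκ′≈1 , (a , a-scales) , (b , b-scales)) =
      V.homo-unique
        (ModuleComposition.isLeftModuleHomomorphism ≈ᴹ-trans φ.φ-homo ψ.φ-homo)
        (ModuleIdentity.isLeftModuleHomomorphism rawLeftModule ≈ᴹ-refl)
        (↑-elim r (λ k → ψ.φ (φ.φ (Y k)) ≈ᴹ Y k) head
          (λ j → ≈ᴹ-trans (homo-cong ψ.φ-homo (φ.φ-tail j)) (ψ.φ-tail j)))
      where
      module φ = Induced u u′ {κ} {a} a-scales
      module ψ = Induced u′ u {κ′} {b} b-scales

      -- As `κ κ′ = 1`, row `k` of the product expresses the `k`-th entry of `(1, u)` through all
      -- entries; by independence it is the unit row.
      ba≈δ : ∀ k i → product b a k i F.≈ δ k i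
      ba≈δ k = K/F.coefficients-unique {v = K.1# ∷ u} u-indep (begin
        K/F.lincomb (product b a k) (K.1# ∷ u)  ≈⟨ scales-∘ {u} {u′} {κ} {a} {κ′} {b} a-scales b-scales k ⟩
        κ K.* κ′ K.* (K.1# ∷ u) k               ≈⟨ K.*-congʳ κκ′≈1 ⟩
        K.1# K.* (K.1# ∷ u) k                   ≈⟨ K.*-identityˡ _ ⟩
        (K.1# ∷ u) k                            ≈⟨ K/F.lincomb-δ k (K.1# ∷ u) ⟨
        K/F.lincomb (δ k) (K.1# ∷ u)            ∎)
        where open SetoidReasoning K.setoid

      head : ∀ i → ψ.φ (φ.φ (A i)) ≈ᴹ A i
      head i = begin
        ψ.φ (φ.φ (A i))                            ≈⟨ homo-cong ψ.φ-homo (φ.φ-A i) ⟩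
        ψ.φ (V/F.lincomb (λ j → a j (suc i)) (generators u′))
          ≈⟨ lincomb-homo/F ψ.φ-homo (λ j → a j (suc i)) (generators u′) ⟩
        V/F.lincomb (λ j → a j (suc i)) (ψ.φ ∘ generators u′)
          ≈⟨ V/F.lincomb-congʳ {a = λ j → a j (suc i)} ψ.φ-generators ⟩
        V/F.lincomb (λ j → a j (suc i)) ψ.combination
          ≈⟨ lincomb-product {a} {b} {generators u} (suc i) ⟩
        V/F.lincomb (λ k → product b a k (suc i)) (generators u)
          ≈⟨ V/F.lincomb-congˡ {v = generators u} (λ k → F.trans (ba≈δ k (suc i)) (δ-sym k (suc i))) ⟩
        V/F.lincomb (δ (suc i)) (generators u)     ≈⟨ V/F.lincomb-δ (suc i) (generators u) ⟩
        A i                                        ∎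
        where open SetoidReasoning ≈ᴹ-setoid

-- Transport of cardinalities, and stabilizers in abelian group actions

module _ (S : Setoid s₁ ℓ₁) (T : Setoid s₂ ℓ₂) where
  private
    module S = Setoid S
    module T = Setoid T

  strictInverse : (to : S.Carrier → T.Carrier) (from : T.Carrier → S.Carrier) →
    (∀ {x y} → x S.≈ y → to x T.≈ to y) → (∀ {x y} → x T.≈ y → from x S.≈ from y) →
    (∀ y → to (from y) T.≈ y) → (∀ x → from (to x) S.≈ x) → Inverse S T
  strictInverse to from to-cong from-cong to∘from from∘to = record
    { to        = to
    ; from      = from
    ; to-cong   = to-cong
    ; from-cong = from-cong
    ; inverse   = (λ x≈fy → T.trans (to-cong x≈fy) (to∘from _)) ,
                  (λ y≈tx → S.trans (from-cong y≈tx) (from∘to _))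
    }

  HasSize-transport : Inverse S T → ∃[ n ] T HasSize n → ∃[ n ] (S HasSize n) × (T HasSize n)
  HasSize-transport S↔T (n , T↔n) = n , Composition.inverse S↔T T↔n , T↔n

module GroupActionProperties {G : Group 0ℓ 0ℓ} {S : Setoid s₁ ℓ₁} (act : GroupAction G S) where
  open GroupAction act
  open Group G using (_∙_; _⁻¹) renaming (_≈_ to _≈ᴳ_; refl to reflᴳ)
  open Setoid S using (_≈_; sym; trans; refl)
  open Setoid orbitSetoid using () renaming (sym to ∼-sym)

  ≈⇒∼ : ∀ {x y} → x ≈ y → x ∼ y
  ≈⇒∼ x≈y = Group.ε G , trans (·-identity _) x≈y

  module _ (comm : Commutative _≈ᴳ_ _∙_) where

    -- Commutativity gives `g · y ≈ g · h · x ≈ h · g · x ≈ h · x ≈ y`.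
    fixes-∼ : ∀ {x y} → x ∼ y → ∀ {g} → g · x ≈ x → g · y ≈ y
    fixes-∼ {x} {y} (h , hx≈y) {g} gx≈x =
      trans (·-cong reflᴳ (sym hx≈y))
        (trans (sym (·-compat g h x))
          (trans (·-cong (comm g h) refl)
            (trans (·-compat h g x)
              (trans (·-cong reflᴳ gx≈x) hx≈y))))

    -- Points of one orbit have the same stabilizer as a subgroup, so the map is the identity on
    -- underlying elements and only the proofs of fixing change.
    Stabilizer-isomorphism : ∀ {x y} (x∼y : x ∼ y) →
      GroupMorphisms.IsGroupIsomorphism (Group.rawGroup (Stabilizer x)) (Group.rawGroup (Stabilizer y))
        (λ (g , gx≈x) → g , fixes-∼ x∼y gx≈x)
    Stabilizer-isomorphism x∼y = record
      { isGroupMonomorphism = record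
        { isGroupHomomorphism = record
          { isMonoidHomomorphism = record
            { isMagmaHomomorphism = record
              { isRelHomomorphism = record { cong = λ g≈h → g≈h }
              ; homo = λ _ _ → reflᴳ
              }
            ; ε-homo = reflᴳ
            }
          ; ⁻¹-homo = λ _ → reflᴳ
          }
        ; injective = λ g≈h → g≈h
        }
      ; surjective = λ (g , gy≈y) → (g , fixes-∼ (∼-sym x∼y) gy≈y) , λ h≈g → h≈g
      }


-- Singer cycle orbits: decidability, finiteness and normal forms

module SingerOrbits {q N : ℕ} (F : FiniteField q) (K : FiniteField N)
  (ι : RingHomomorphism (FiniteField.rawRing F) (FiniteField.rawRing K))
  where

  private
    module F = FiniteField F
    module K = FiniteField K
    module Fˢ = Finite F.size
    module Kˢ = Finite K.size

    K/K : LeftModule K.ring 0ℓ 0ℓ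
    K/K = regularModule

    K/F : LeftModule F.ring 0ℓ 0ℓ
    K/F = restrictScalars F.ring K.ring ι K/K

    module K/F where
      open LinearAlgebra K/F public
      open LincombProperties K/F public

    Kˣ-action : K/F.LinearAction (multiplicativeGroup K)
    Kˣ-action = restrictAction F.ring K.ring ι K/K (multiplicationAction K)

    open K/F.Subspace

    variable
      d : ℕ
      U W : K/F.Subspace

  module H where
    open GroupAction (K/F.subspaceAction Kˣ-action) public
    open GroupActionProperties (K/F.subspaceAction Kˣ-action) public
    open Setoid orbitSetoid public using () renaming (refl to ∼-refl; sym to ∼-sym; trans to ∼-trans)

  HasStabilizer : ∀ {n} → FiniteField n → Pred K/F.Subspace 0ℓ
  HasStabilizer L W = H.Stabilizer W ≅ multiplicativeGroup L

  HasStabilizer-resp-∼ : ∀ {n} {L : FiniteField n} → U H.∼ W → HasStabilizer L U → HasStabilizer L W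
  HasStabilizer-resp-∼ {U} {W} {L = L} U∼W (f , f-iso) = _ ,
    GroupComposition.isGroupIsomorphism (FiniteField.trans L)
      (H.Stabilizer-isomorphism (λ (g , _) (h , _) → K.*-comm g h) {W} {U} (H.∼-sym {U} {W} U∼W)) f-iso

  ∈-span? : ∀ (v : Vector K.Carrier d) → Decidable (member (K/F.span v))
  ∈-span? {d} v x = Finite.∃? (Fˢ.vector d)
    (λ a≈b av≈x → K.trans (K/F.lincomb-congˡ {v = v} (λ i → F.sym (a≈b i))) av≈x)
    (λ a → K/F.lincomb a v Kˢ.≟ x)

  private
    ≐? : Decidable (member U) → Decidable (member W) → Dec (member U ≐ member W)
    ≐? {U} {W} U? W? = map′
      (λ U⇔W → (λ {x} → proj₁ (U⇔W x)) , (λ {x} → proj₂ (U⇔W x)))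
      (λ (U⊆W , W⊆U) x → U⊆W , W⊆U)
      (Kˢ.∀?
        (λ x≈y (U⇒W , W⇒U) →
          (λ y∈U → ≈-closed W x≈y (U⇒W (≈-closed U (K.sym x≈y) y∈U))) ,
          (λ y∈W → ≈-closed U x≈y (W⇒U (≈-closed W (K.sym x≈y) y∈W))))
        (λ x → (U? x →-dec W? x) ×-dec (W? x →-dec U? x)))

    image? : ∀ h → Decidable (member U) → Decidable (member (K/F.image Kˣ-action h U))
    image? {U} (h , _) U? y = Kˢ.∃?
      (λ x≈x′ (x∈U , hx≈y) → ≈-closed U x≈x′ x∈U , K.trans (K.*-congˡ (K.sym x≈x′)) hx≈y)
      (λ x → U? x ×-dec ((h K.* x) Kˢ.≟ y))

    -- Nonvanishing of `h` is packed into a predicate on all of `K`, since the exhaustive search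
    -- runs over `K`. For `U = W` it describes the stabilizer.
    Carries : K/F.Subspace → K/F.Subspace → Pred K.Carrier 0ℓ
    Carries U W h = Σ (¬ h K.≈ K.0#) λ h≉0 → member (K/F.image Kˣ-action (h , h≉0) U) ≐ member W

    carries? : Decidable (member U) → Decidable (member W) → Decidable (Carries U W)
    carries? {U} {W} U? W? h with h Kˢ.≟ K.0#
    ... | yes h≈0 = no λ (h≉0 , _) → h≉0 h≈0
    ... | no h≉0  = map′ (h≉0 ,_) proj₂
      (≐? {K/F.image Kˣ-action (h , h≉0) U} {W} (image? {U} (h , h≉0) U?) W?)

    carries-resp : ∀ {g h} → g K.≈ h → Carries U W g → Carries U W h
    carries-resp {U} {W} {g} {h} g≈h (g≉0 , gU≐W) =
      h≉0 , Setoid.trans K/F.subspaceSetoid {K/F.image Kˣ-action (h , h≉0) U} {K/F.image Kˣ-action (g , g≉0) U} {W}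
        (H.·-cong {h , h≉0} {g , g≉0} {U} {U} (K.sym g≈h) (Setoid.refl K/F.subspaceSetoid {U})) gU≐W
      where
      h≉0 : ¬ h K.≈ K.0#
      h≉0 h≈0 = g≉0 (K.trans g≈h h≈0)

    ∼? : Decidable (member U) → Decidable (member W) → Dec (U H.∼ W)
    ∼? {U} {W} U? W? = map′
      (λ (h , h≉0 , hU≐W) → (h , h≉0) , hU≐W)
      (λ ((h , h≉0) , hU≐W) → h , h≉0 , hU≐W)
      (Kˢ.∃? (carries-resp {U} {W}) (carries? {U} {W} U? W?))

    independent? : ∀ (v : Vector K.Carrier d) → Dec (K/F.LinearlyIndependent v)
    independent? {d} v = Finite.∀? (Fˢ.vector d)
      (λ a≈b a-trivial bv≈0 i → F.trans (F.sym (a≈b i))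
        (a-trivial (K.trans (K/F.lincomb-congˡ {v = v} a≈b) bv≈0) i))
      (λ a → (K/F.lincomb a v Kˢ.≟ K.0#) →-dec Fin.all? (λ i → a i Fˢ.≟ F.0#))

    Stabilizer-finite : Decidable (member U) → ∃[ n ] Group.setoid (H.Stabilizer U) HasSize n
    Stabilizer-finite {U} U? = Kˢ.finiteSubquotient (Group.setoid (H.Stabilizer U))
      (λ ((g , _) , _) ((h , _) , _) → g Kˢ.≟ h)
      (carries-resp {U} {U}) (carries? {U} {U} U? U?)
      (λ h (h≉0 , hU≐U) → (h , h≉0) , hU≐U)
      (λ ((h , h≉0) , hU≐U) → h , (h≉0 , hU≐U) , λ _ h≈g _ → K.sym h≈g)

  multiplicativeGroup-finite : ∀ {n} (L : FiniteField n) →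
    ∃[ n ] Group.setoid (multiplicativeGroup L) HasSize n
  multiplicativeGroup-finite L = Lˢ.finiteSubquotient (Group.setoid (multiplicativeGroup L))
    (λ (x , _) (y , _) → x Lˢ.≟ y)
    (λ x≈y x≉0 y≈0 → x≉0 (L.trans x≈y y≈0)) (λ x → ¬? (x Lˢ.≟ L.0#))
    _,_
    (λ (x , x≉0) → x , x≉0 , λ _ x≈y _ → L.sym x≈y)
    where
    module L = FiniteField L
    module Lˢ = Finite L.size

  hasStabilizer? : ∀ {n} (L : FiniteField n) → Decidable (member U) → Dec (HasStabilizer L U)
  hasStabilizer? {U} L U? = ≅-dec (H.Stabilizer U) (multiplicativeGroup L)
    (proj₂ (Stabilizer-finite {U} U?)) (proj₂ (multiplicativeGroup-finite L))

  independent⇒dimension : ∀ {v : Vector K.Carrier d} → K/F.LinearlyIndependent v → K/F.HasDimension d (K/F.span v)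
  independent⇒dimension {v = v} indep = v , indep , Setoid.refl K/F.subspaceSetoid {K/F.span v}

  -- Each member of `Q` has a basis, so the spans of the independent `d`-tuples over `K` that
  -- satisfy `Q` meet every orbit. There are finitely many tuples, and the orbit relation between
  -- members of `Q` is decidable.
  orbits-finite : (Q : Pred K/F.Subspace 0ℓ) →
    (∀ {W} → Q W → K/F.HasDimension d W) →
    (∀ {W v} → K/F.LinearlyIndependent {d} v → W H.∼ K/F.span v → Q W → Q (K/F.span v)) →
    (∀ v → K/F.LinearlyIndependent {d} v → Dec (Q (K/F.span v))) →
    ∃[ n ] H.Orbits Q HasSize n
  orbits-finite {d} Q Q⇒dim Q-resp Q? =
    Finite.finiteSubquotient (Kˢ.vector d) (H.Orbits Q) _≟_ {P = P} P-resp P?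
      (λ v (_ , q) → K/F.span v , q)
      λ (W , q) → let (v , indep , W≐⟨v⟩) = Q⇒dim q in
        v , (indep , Q-resp {W} {v} indep (H.≈⇒∼ {W} {K/F.span v} W≐⟨v⟩) q) ,
        λ w v≈w _ → H.≈⇒∼ {K/F.span w} {W}
          (Setoid.trans K/F.subspaceSetoid {K/F.span w} {K/F.span v} {W}
            (K/F.span-cong {v = w} {w = v} (λ i → K.sym (v≈w i)))
            (Setoid.sym K/F.subspaceSetoid {W} {K/F.span v} W≐⟨v⟩))
    where
    P : Pred (Vector K.Carrier d) 0ℓ
    P v = K/F.LinearlyIndependent v × Q (K/F.span v)

    P-resp : ∀ {v w} → (∀ i → v i K.≈ w i) → P v → P w
    P-resp {v} {w} v≈w (indep , q) =
      let w-indep = K/F.LinearlyIndependent-cong {v = v} {w = w} v≈w indep in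
      w-indep , Q-resp {K/F.span v} {w} w-indep (H.≈⇒∼ {K/F.span v} {K/F.span w} (K/F.span-cong {v = v} {w = w} v≈w)) q

    P? : Decidable P
    P? v with independent? v
    ... | no ¬indep = no (¬indep ∘ proj₁)
    ... | yes indep = map′ (indep ,_) proj₂ (Q? v indep)

    -- A subspace is an arbitrary predicate; the basis obtained from its dimension makes membership
    -- decidable.
    member? : ((W , q) : ∃ Q) → Decidable (member W)
    member? (W , q) x = let (v , _ , W⊆⟨v⟩ , ⟨v⟩⊆W) = Q⇒dim q in
      map′ ⟨v⟩⊆W W⊆⟨v⟩ (∈-span? v x)

    _≟_ : ∀ ((U , _) (W , _) : ∃ Q) → Dec (U H.∼ W)
    Uq@(U , _) ≟ Wq@(W , _) = ∼? {U} {W} (member? Uq) (member? Wq)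

  -- A member of an independent family is nonzero, so multiplication by the inverse of `v zero`
  -- brings the first entry to `1`.
  normalise : ∀ {v : Vector K.Carrier (suc d)} → K/F.LinearlyIndependent v →
    ∃[ u ] K/F.LinearlyIndependent (K.1# ∷ u) × K/F.span v H.∼ K/F.span (K.1# ∷ u)
  normalise {d} {v} indep = u , u-indep , (h , h≉0) , Setoid.trans K/F.subspaceSetoid
    {K/F.image Kˣ-action (h , h≉0) (K/F.span v)} {K/F.span hv} {K/F.span (K.1# ∷ u)}
    (K/F.image-span Kˣ-action (h , h≉0) v)
    (K/F.span-cong {v = hv} {w = K.1# ∷ u} hv≈1∷u)
    where
    open Kronecker F.ring using (δ)
    open SetoidReasoning K.setoid

    v₀≉0 : ¬ v zero K.≈ K.0#
    v₀≉0 v₀≈0 = F.1≉0 (indep (δ zero) (K.trans (K/F.lincomb-δ zero v) v₀≈0) zero)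

    h : K.Carrier
    h = proj₁ (K.invertible (v zero) v₀≉0)

    hv₀≈1 : h K.* v zero K.≈ K.1#
    hv₀≈1 = proj₁ (proj₂ (K.invertible (v zero) v₀≉0))

    v₀h≈1 : v zero K.* h K.≈ K.1#
    v₀h≈1 = proj₂ (proj₂ (K.invertible (v zero) v₀≉0))

    h≉0 : ¬ h K.≈ K.0#
    h≉0 h≈0 = K.1≉0 (K.trans (K.sym hv₀≈1) (K.trans (K.*-congʳ h≈0) (K.zeroˡ _)))

    hv : Vector K.Carrier (suc d)
    hv i = h K.* v i

    u : Vector K.Carrier d
    u i = hv (suc i)

    hv≈1∷u : ∀ i → hv i K.≈ (K.1# ∷ u) i
    hv≈1∷u zero    = hv₀≈1
    hv≈1∷u (suc i) = K.refl

    hv-indep : K/F.LinearlyIndependent hv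
    -- Multiplication by `v zero`, the inverse of `h`, undoes the scaling.
    hv-indep a ahv≈0 = indep a (begin
      K/F.lincomb a v                             ≈⟨ K.*-identityˡ _ ⟨
      K.1# K.* K/F.lincomb a v                    ≈⟨ K.*-congʳ v₀h≈1 ⟨
      v zero K.* h K.* K/F.lincomb a v            ≈⟨ K.*-assoc _ _ _ ⟩
      v zero K.* (h K.* K/F.lincomb a v)
        ≈⟨ K.*-congˡ (K/F.lincomb-homo (K/F.LinearAction.isHomomorphism Kˣ-action (h , h≉0)) a v) ⟩
      v zero K.* K/F.lincomb a hv                 ≈⟨ K.*-congˡ ahv≈0 ⟩
      v zero K.* K.0#                             ≈⟨ K.zeroʳ _ ⟩
      K.0#                                        ∎)

    u-indep : K/F.LinearlyIndependent (K.1# ∷ u)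
    u-indep = K/F.LinearlyIndependent-cong {v = hv} {w = K.1# ∷ u} hv≈1∷u hv-indep

-- The bijection between `G`-orbits and `H`-orbits

module Correspondence
  {q l r s n : ℕ} (F : FiniteField q) (K : FiniteField (q ^ l))
  (ι : RingHomomorphism (FiniteField.rawRing F) (FiniteField.rawRing K))
  (V : LeftModule (FiniteField.ring K) 0ℓ 0ℓ) (Y : Vector (LeftModule.Carrierᴹ V) (r + (s + n)))
  (Y-basis : LinearAlgebra.IsBasis V Y)
  (k≤ : suc (r + s) ≤ (r + (s + n) + 1) ⊓ l) (1≤r : 1 ≤ r) (r≤k-1 : r ≤ r + s)
  where

  private
    module F = FiniteField F
    module K = FiniteField K
    open LeftModule V
    module S = Setting F K ι V Y k≤ r≤k-1
    module O = Orbits {F.commutativeRing} {K.commutativeRing} ι V {r} {s} {n} 1≤r Y-basis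
    open SingerOrbits F K ι
    module G where
      open S.G-action public
      open GroupActionProperties (S.V/F.subspaceAction (restrictAction F.ring K.ring ι V (GL-action V))) public
      open Setoid orbitSetoid public using () renaming (refl to ∼-refl; sym to ∼-sym; trans to ∼-trans)
    module K/F where
      open LinearAlgebra S.K/F public
      open LincombProperties S.K/F public
    module V/F where
      open LinearAlgebra S.V/F public
      open LincombProperties S.V/F public
    open V/F.Subspace

    variable
      u u′ : Vector K.Carrier r

    ⟨1,_⟩ : Vector K.Carrier r → K/F.Subspace
    ⟨1, u ⟩ = K/F.span (K.1# ∷ u)

  -- The spanning families differ in order, in the sign of `Σ u_i Y_i` and in how `Y` is indexed.
  -- The sign is harmless in a subspace, and the indices agree under `toℕ`.
  T≐T : ∀ u → member (S.T u) ≐ member (O.T u)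
  T≐T u =
    V/F.span-⊆ {v = S-generators} (O.T u)
      (↑-elim (r + s) (λ k → member (O.T u) (S-generators k))
        (λ i → ≈-closed (O.T u) (≈ᴹ-reflexive (≡.sym (lookup-++ˡ Yᵏ (w ∷ []) i)))
          (↑-elim r (λ k → member (O.T u) (Yᵏ k))
            (λ i → ≈-closed (O.T u) (Y-A′ i) (O.generator∈T u (suc i)))
            (λ j → ≈-closed (O.T u) (Y-B j) (O.B∈T u j)) i))
        (λ { zero → ≈-closed (O.T u)
          (≈ᴹ-trans (≈ᴹ-trans (-ᴹ-involutive _) wᴬ≈w) (≈ᴹ-reflexive (≡.sym (lookup-++ʳ Yᵏ (w ∷ []) zero))))
          (V/F.-ᴹ-closed (O.T u) (O.generator∈T u zero)) })) ,
    V/F.span-⊆ {v = O.generators u ++ O.B} (S.T u)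
      (↑-elim (suc r) (λ k → member (S.T u) ((O.generators u ++ O.B) k))
        (λ { zero → V/F.-ᴹ-closed (S.T u) (≈-closed (S.T u)
               (≈ᴹ-trans (≈ᴹ-reflexive (lookup-++ʳ Yᵏ (w ∷ []) zero)) (≈ᴹ-sym wᴬ≈w))
               (V/F.∈-span S-generators ((r + s) ↑ʳ zero)))
           ; (suc i) → ≈-closed (S.T u)
               (≈ᴹ-trans (≈ᴹ-sym (Y-A′ i)) (≈ᴹ-reflexive (≡.sym (lookup-++ˡ (O.generators u) O.B (suc i)))))
               (Yᵏ∈T (i ↑ˡ s)) })
        (λ j → ≈-closed (S.T u)
          (≈ᴹ-trans (≈ᴹ-sym (Y-B j)) (≈ᴹ-reflexive (≡.sym (lookup-++ʳ (O.generators u) O.B j))))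
          (Yᵏ∈T (r ↑ʳ j))))
    where
    open LeftModuleProperties V using (-ᴹ-involutive)

    .r≤m : r ≤ r + (s + n)
    r≤m = ℕ.≤-trans r≤k-1 S.k-1≤m

    Yᵏ : Vector Carrierᴹ (r + s)
    Yᵏ i = Y (inject≤ i S.k-1≤m)

    w = LinearAlgebra.lincomb V u (λ i → Y (inject≤ i r≤m))
    S-generators = Yᵏ ++ (w ∷ [])

    Yᵏ∈T : ∀ i → member (S.T u) (Yᵏ i)
    Yᵏ∈T i = ≈-closed (S.T u) (≈ᴹ-reflexive (lookup-++ˡ Yᵏ (w ∷ []) i)) (V/F.∈-span S-generators (i ↑ˡ 1))

    Y-cong : ∀ {i j} → toℕ i ≡ toℕ j → Y i ≈ᴹ Y j
    Y-cong = ≈ᴹ-reflexive ∘ ≡.cong Y ∘ Fin.toℕ-injective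

    Y-A : ∀ i → O.A i ≈ᴹ Y (inject≤ i r≤m)
    Y-A i = Y-cong (≡.trans (Fin.toℕ-↑ˡ i (s + n)) (≡.sym (Fin.toℕ-inject≤ i r≤m)))

    Y-A′ : ∀ i → O.A i ≈ᴹ Yᵏ (i ↑ˡ s)
    Y-A′ i = Y-cong (≡.trans (Fin.toℕ-↑ˡ i (s + n))
      (≡.sym (≡.trans (Fin.toℕ-inject≤ (i ↑ˡ s) S.k-1≤m) (Fin.toℕ-↑ˡ i s))))

    Y-B : ∀ j → O.B j ≈ᴹ Yᵏ (r ↑ʳ j)
    Y-B j = Y-cong (≡.trans (≡.trans (Fin.toℕ-↑ʳ r (j ↑ˡ n)) (≡.cong (r +_) (Fin.toℕ-↑ˡ j n)))
      (≡.sym (≡.trans (Fin.toℕ-inject≤ (r ↑ʳ j) S.k-1≤m) (Fin.toℕ-↑ʳ r j))))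

    wᴬ≈w : LinearAlgebra.lincomb V u O.A ≈ᴹ w
    wᴬ≈w = LincombProperties.lincomb-congʳ V {a = u} Y-A

  equivalent⇒∼ : O.Equivalent u u′ → ⟨1, u ⟩ H.∼ ⟨1, u′ ⟩
  equivalent⇒∼ {u} {u′} (κ , κ′ , κκ′≈1 , (a , a-scales) , (b , b-scales)) =
    -- `κ⟨1, u′⟩ = ⟨1, u⟩`, so it is `κ′`, and not `κ`, that moves `⟨1, u ⟩` to `⟨1, u′ ⟩`.
    (κ′ , κ′≉0) , Setoid.trans K/F.subspaceSetoid
      {K/F.image act (κ′ , κ′≉0) ⟨1, u ⟩} {K/F.span κ′e} {⟨1, u′ ⟩}
      (K/F.image-span act (κ′ , κ′≉0) (K.1# ∷ u))
      (K/F.span-⊆ {v = κ′e} ⟨1, u′ ⟩ (λ i → b i , b-scales i) ,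
       K/F.span-⊆ {v = K.1# ∷ u′} (K/F.span κ′e) λ j → a j , (begin
         K/F.lincomb (a j) κ′e
           ≈⟨ K/F.lincomb-homo (K/F.LinearAction.isHomomorphism act (κ′ , κ′≉0)) (a j) (K.1# ∷ u) ⟨
         κ′ K.* K/F.lincomb (a j) (K.1# ∷ u)     ≈⟨ K.*-congˡ (a-scales j) ⟩
         κ′ K.* (κ K.* (K.1# ∷ u′) j)            ≈⟨ K.*-assoc _ _ _ ⟨
         κ′ K.* κ K.* (K.1# ∷ u′) j              ≈⟨ K.*-congʳ (K.trans (K.*-comm κ′ κ) κκ′≈1) ⟩
         K.1# K.* (K.1# ∷ u′) j                  ≈⟨ K.*-identityˡ _ ⟩
         (K.1# ∷ u′) j                           ∎))
    where
    open SetoidReasoning K.setoid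
    act = restrictAction F.ring K.ring ι S.K/K (multiplicationAction K)

    κ′e : Vector K.Carrier (suc r)
    κ′e i = κ′ K.* (K.1# ∷ u) i

    κ′≉0 : ¬ κ′ K.≈ K.0#
    κ′≉0 κ′≈0 = K.1≉0 (K.trans (K.sym κκ′≈1) (K.trans (K.*-congˡ κ′≈0) (K.zeroʳ κ)))

  ∼⇒equivalent : ⟨1, u ⟩ H.∼ ⟨1, u′ ⟩ → O.Equivalent u u′
  ∼⇒equivalent {u} {u′} ((h , h≉0) , h⟨u⟩⊆⟨u′⟩ , ⟨u′⟩⊆h⟨u⟩) =
    -- As in `equivalent⇒∼`, `h` plays the part of `κ′` and its inverse that of `κ`; the matrices
    -- are the coefficients found in the spans.
    h⁻¹ , h , h⁻¹h≈1 ,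
    ((λ j → proj₁ (from j)) , λ j → proj₂ (from j)) ,
    ((λ i → proj₁ (to i)) , λ i → proj₂ (to i))
    where
    open SetoidReasoning K.setoid

    h⁻¹ : K.Carrier
    h⁻¹ = proj₁ (K.invertible h h≉0)

    h⁻¹h≈1 : h⁻¹ K.* h K.≈ K.1#
    h⁻¹h≈1 = proj₁ (proj₂ (K.invertible h h≉0))

    to : ∀ i → K/F.Subspace.member ⟨1, u′ ⟩ (h K.* (K.1# ∷ u) i)
    to i = h⟨u⟩⊆⟨u′⟩ ((K.1# ∷ u) i , K/F.∈-span (K.1# ∷ u) i , K.refl)

    from : ∀ j → K/F.Subspace.member ⟨1, u ⟩ (h⁻¹ K.* (K.1# ∷ u′) j)
    from j = let (x , x∈⟨u⟩ , hx≈e′) = ⟨u′⟩⊆h⟨u⟩ (K/F.∈-span (K.1# ∷ u′) j) in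
      K/F.Subspace.≈-closed ⟨1, u ⟩ (begin
        x                             ≈⟨ K.*-identityˡ x ⟨
        K.1# K.* x                    ≈⟨ K.*-congʳ h⁻¹h≈1 ⟨
        h⁻¹ K.* h K.* x               ≈⟨ K.*-assoc _ _ _ ⟩
        h⁻¹ K.* (h K.* x)             ≈⟨ K.*-congˡ hx≈e′ ⟩
        h⁻¹ K.* (K.1# ∷ u′) j         ∎) x∈⟨u⟩

  T∼T⇒∼ : O.LI u → O.LI u′ → S.T u G.∼ S.T u′ → ⟨1, u ⟩ H.∼ ⟨1, u′ ⟩
  T∼T⇒∼ {u} {u′} u-indep u′-indep Tu∼Tu′ = equivalent⇒∼ {u} {u′} (O.T∼T⇒equivalent {u} {u′} u-indep u′-indep
    (G.∼-trans {O.T u} {S.T u} {O.T u′} (G.∼-sym {S.T u} {O.T u} (G.≈⇒∼ {S.T u} {O.T u} (T≐T u)))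
      (G.∼-trans {S.T u} {S.T u′} {O.T u′} Tu∼Tu′ (G.≈⇒∼ {S.T u′} {O.T u′} (T≐T u′)))))

  ∼⇒T∼T : O.LI u → O.LI u′ → ⟨1, u ⟩ H.∼ ⟨1, u′ ⟩ → S.T u G.∼ S.T u′
  ∼⇒T∼T {u} {u′} u-indep u′-indep u∼u′ =
    G.∼-trans {S.T u} {O.T u} {S.T u′} (G.≈⇒∼ {S.T u} {O.T u} (T≐T u))
      (G.∼-trans {O.T u} {O.T u′} {S.T u′}
        (O.equivalent⇒T∼T {u} {u′} u-indep u′-indep (∼⇒equivalent {u} {u′} u∼u′))
        (G.∼-sym {S.T u′} {O.T u′} (G.≈⇒∼ {S.T u′} {O.T u′} (T≐T u′))))

  -- One argument for both counts: `P` is a condition on subspaces of `V` and `Q` the matching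
  -- condition on `⟨1, u ⟩`. The parameter `u` extracted from a proof of `P` is a choice; `T∼T⇒∼`
  -- makes the resulting `H`-orbit independent of it.
  module _ (P : Pred V/F.Subspace 0ℓ) (Q : Pred K/F.Subspace 0ℓ)
    (P⇒ : ∀ {U} → P U → ∃[ u ] O.LI u × Q ⟨1, u ⟩ × S.T u G.∼ U)
    (⇒P : ∀ {u} → O.LI u → Q ⟨1, u ⟩ → P (S.T u))
    (Q⇒dim : ∀ {W} → Q W → K/F.HasDimension (suc r) W)
    (Q-resp : ∀ {W v} → K/F.LinearlyIndependent {suc r} v → W H.∼ K/F.span v → Q W → Q (K/F.span v))
    where

    private
      to : ∃ P → ∃ Q
      to (U , p) = let (u , _ , q , _) = P⇒ p in ⟨1, u ⟩ , q

      -- Scaling a basis of `W` makes its first entry `1`; the other entries are the parameter of a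
      -- `T u`.
      dehomogenise : ((W , _) : ∃ Q) → ∃[ u ] O.LI u × W H.∼ ⟨1, u ⟩
      dehomogenise (W , q) =
        let (v , indep , W≐⟨v⟩) = Q⇒dim q
            (u , u-indep , v∼u) = normalise {v = v} indep
        in u , u-indep , H.∼-trans {W} {K/F.span v} {⟨1, u ⟩} (H.≈⇒∼ {W} {K/F.span v} W≐⟨v⟩) v∼u

      from : ∃ Q → ∃ P
      from (W , q) = let (u , u-indep , W∼u) = dehomogenise (W , q) in
        S.T u , ⇒P {u} u-indep (Q-resp {W} {K.1# ∷ u} u-indep W∼u q)

      to-cong : ∀ {x y} → proj₁ x G.∼ proj₁ y → proj₁ (to x) H.∼ proj₁ (to y)
      to-cong {U , p} {U′ , p′} U∼U′ =
        let (u , u-indep , _ , Tu∼U) = P⇒ p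
            (u′ , u′-indep , _ , Tu′∼U′) = P⇒ p′
        in T∼T⇒∼ {u} {u′} u-indep u′-indep (G.∼-trans {S.T u} {U} {S.T u′} Tu∼U
             (G.∼-trans {U} {U′} {S.T u′} U∼U′ (G.∼-sym {S.T u′} {U′} Tu′∼U′)))

      from-cong : ∀ {x y} → proj₁ x H.∼ proj₁ y → proj₁ (from x) G.∼ proj₁ (from y)
      from-cong {W , q} {W′ , q′} W∼W′ =
        let (u , u-indep , W∼u) = dehomogenise (W , q)
            (u′ , u′-indep , W′∼u′) = dehomogenise (W′ , q′)
        in ∼⇒T∼T {u} {u′} u-indep u′-indep (H.∼-trans {⟨1, u ⟩} {W} {⟨1, u′ ⟩} (H.∼-sym {W} {⟨1, u ⟩} W∼u)
             (H.∼-trans {W} {W′} {⟨1, u′ ⟩} W∼W′ W′∼u′))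

      to∘from : ∀ y → proj₁ (to (from y)) H.∼ proj₁ y
      to∘from (W , q) =
        let (u , u-indep , W∼u) = dehomogenise (W , q)
            -- The parameter recovered from `T u` may differ from `u`; only the orbits of `⟨1, u′ ⟩`
            -- and `⟨1, u ⟩` are known to agree.
            (u′ , u′-indep , _ , Tu′∼Tu) = P⇒ (proj₂ (from (W , q)))
        in H.∼-trans {⟨1, u′ ⟩} {⟨1, u ⟩} {W} (T∼T⇒∼ {u′} {u} u′-indep u-indep Tu′∼Tu) (H.∼-sym {W} {⟨1, u ⟩} W∼u)

      from∘to : ∀ x → proj₁ (from (to x)) G.∼ proj₁ x
      from∘to (U , p) =
        let (u , u-indep , q , Tu∼U) = P⇒ p
            (u′ , u′-indep , u∼u′) = dehomogenise (⟨1, u ⟩ , q)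
        in G.∼-trans {S.T u′} {S.T u} {U}
             (∼⇒T∼T {u′} {u} u′-indep u-indep (H.∼-sym {⟨1, u ⟩} {⟨1, u′ ⟩} u∼u′)) Tu∼U

    orbit-correspondence : Inverse (G.Orbits P) (H.Orbits Q)
    orbit-correspondence = strictInverse (G.Orbits P) (H.Orbits Q)
      to from (λ {x} {y} → to-cong {x} {y}) (λ {x} {y} → from-cong {x} {y}) to∘from from∘to

    equal-counts : (∀ v → K/F.LinearlyIndependent {suc r} v → Dec (Q (K/F.span v))) →
      ∃[ n ] (G.Orbits P HasSize n) × (H.Orbits Q HasSize n)
    equal-counts Q? = HasSize-transport (G.Orbits P) (H.Orbits Q) orbit-correspondence
      (orbits-finite {d = suc r} Q (λ {W} → Q⇒dim {W}) (λ {W} {v} → Q-resp {W} {v}) Q?)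

  orbit-counts : ∃[ n ] (S.G-Orbits HasSize n) × (S.H-Orbits (suc r) HasSize n)
  orbit-counts = equal-counts S.Ω (K/F.HasDimension (suc r))
    (λ (u , u-indep , Tu∼U) → u , u-indep , independent⇒dimension {v = K.1# ∷ u} u-indep , Tu∼U)
    (λ {u} u-indep _ → u , u-indep , G.∼-refl {S.T u})
    (λ dim → dim)
    (λ {_} {v} v-indep _ _ → independent⇒dimension {v = v} v-indep)
    (λ v v-indep → yes (independent⇒dimension {v = v} v-indep))

  stabilizer-orbit-counts : ∀ {t} (L : FiniteField t) →
    ∃[ n ] (S.G-Orbits[ L ] HasSize n) × (S.H-Orbits[ L ] (suc r) HasSize n)
  stabilizer-orbit-counts L = equal-counts S.Ω[ L ] (λ W → K/F.HasDimension (suc r) W × S.HasStabilizer L W)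
    (λ (u , u-indep , stab , Tu∼U) → u , u-indep , (independent⇒dimension {v = K.1# ∷ u} u-indep , stab) , Tu∼U)
    (λ {u} u-indep (_ , stab) → u , u-indep , stab , G.∼-refl {S.T u})
    proj₁
    -- `H` is abelian, so the stabilizer condition passes from `W` to any span in its orbit.
    (λ {W} {v} v-indep W∼⟨v⟩ (_ , stab) → independent⇒dimension {v = v} v-indep ,
      HasStabilizer-resp-∼ {W} {K/F.span v} {L = L} W∼⟨v⟩ stab)
    (λ v v-indep → map′ (independent⇒dimension {v = v} v-indep ,_) proj₂ (hasStabilizer? {K/F.span v} L (∈-span? v)))

corollary3p3 : ∀ {q m l k r : ℕ} → IsPrimePower q →
    3 ≤ k → (k≤ : k ≤ (m + 1) ⊓ l) → 1 ≤ r → (r≤k-1 : r ≤ k ∸ 1) →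
    (F : FiniteField q) (K : FiniteField (q ^ l))
    (ι : RingHomomorphism (FiniteField.rawRing F) (FiniteField.rawRing K))
    (V : LeftModule (FiniteField.ring K) 0ℓ 0ℓ) (Y : Vector (LeftModule.Carrierᴹ V) m) →
    LinearAlgebra.IsBasis V Y →
    let open Setting F K ι V Y k≤ r≤k-1 in
    (∃[ n ] (G-Orbits HasSize n) × (H-Orbits (r + 1) HasSize n)) ×
    (∀ u → 1 ≤ u → u ∣ gcd (r + 1) l → (L : FiniteField (q ^ u)) →
    ∃[ n ] (G-Orbits[ L ] HasSize n) × (H-Orbits[ L ] (r + 1) HasSize n))
corollary3p3 {m = m} {l} {suc k} {r} _ _ k≤ 1≤r r≤k F K ι V Y Y-basis
  -- After the match on `suc k` the variable `k` stands for the former `k - 1`, zero being excluded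
  -- by `3 ≤ k`. Then `s = k - r` and `n = m - k` give `m` the form `r + (s + n)` that
  -- `Correspondence` takes.
  with ℕ.m≤n⇒∃[o]m+o≡n r≤k
... | s , ≡.refl with ℕ.m≤n⇒∃[o]m+o≡n (Setting.k-1≤m F K ι V Y k≤ r≤k)
... | n , eq with ≡.trans (≡.sym (ℕ.+-assoc r s n)) eq
... | ≡.refl rewrite ℕ.+-comm r 1 = orbit-counts , λ _ _ _ L → stabilizer-orbit-counts L
  where open Correspondence F K ι V Y Y-basis k≤ 1≤r r≤k
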